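{- Let $n\ge 2$ and $k\ge1$. With the crystal operators $e_i,f_i$ and K-crystal operators $e_i^K,f_i^K$ ($1\le i<n$) below, $\mathrm{SVT}^n((k))$ is a K-crystal, i.e.: (K.1) the graph on $\mathrm{SVT}^n((k))$ with edges $T\to f_iT$ and $T\to f_i^KT$ (nonzero) is connected, and $u$ is the only element with $e_iu=0$ and $e_i^Ku=0$ for all $i$; (K.2) for every $w\in S_n$ the set $\mathrm{SVT}^n_w(k\Lambda_1)$ does not depend on the choice of reduced expression of $w$; (K.3) for every $w\in S_n$ with reduced expression $w=s_{i_1}\cdots s_{i_\ell}$, \[\sum_{T\in\mathrm{SVT}^n_w(k\Lambda_1)}\beta^{\mathrm{ex}(T)}x^{\mathrm{wt}(T)}=\varpi_{i_1}\cdots\varpi_{i_\ell}\,x_1^k,\] the Lascoux polynomial $L_{w\lambda}$ for $\lambda=(k,0,\dots,0)$.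
   Context: $\mathrm{SVT}^n((k))$: sequences of nonempty sets $A_1,\dots,A_k\subseteq\{1,\dots,n\}$ with $\max A_j\le\min A_{j+1}$ ($1\times k$ semistandard set-valued tableaux). $\mathrm{wt}(T)=(c_1,\dots,c_n)$ with $c_j$ the number of boxes containing $j$; $\mathrm{ex}(T)=\sum_j(|A_j|-1)$. $u$ is the row with all boxes $\{1\}$. Crystal operators ($1\le i<n$): write $+$ above each box containing $i$ but not $i+1$ and $-$ above each box containing $i+1$ but not $i$; reading left to right, repeatedly delete adjacent pairs $-+$. If no $+$ remains, $f_iT=0$; otherwise let $\mathsf b$ be the box of the rightmost remaining $+$ and $\mathsf b^\rightarrow$ the next box; if $i\notin\mathsf b^\rightarrow$, $f_iT$ replaces $i$ by $i+1$ in $\mathsf b$, else removes $i$ from $\mathsf b^\rightarrow$ and adds $i+1$ to $\mathsf b$. If no $-$ remains, $e_iT=0$; otherwise let $\mathsf b$ be the box of the leftmost remaining $-$ and $\mathsf b^\leftarrow$ the previous box; if $i+1\notin\mathsf b^\leftarrow$, $e_iT$ replaces $i+1$ by $i$ in $\mathsf b$, else removes $i+1$ from $\mathsf b^\leftarrow$ and adds $i$ to $\mathsf b$. K-crystal operators: $f_i^KT=0$ if $i\notin T$ or $i+1\in T$; otherwise $f_i^KT$ adds $i+1$ to the rightmost box containing $i$. $e_i^KT=0$ if no box contains both $i$ and $i+1$; otherwise $e_i^KT$ deletes $i+1$ from that box. For $g\in\{e_i,e_i^K\}$, $g^{\max}T=g^rT$ with $r$ maximal such that $g^rT\ne0$.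 K-Demazure crystal for a reduced expression $w=s_{i_1}\cdots s_{i_\ell}$: $\mathrm{SVT}^n_w(k\Lambda_1)=\{T : (e^K_{i_\ell})^{\max}e_{i_\ell}^{\max}\cdots(e^K_{i_1})^{\max}e_{i_1}^{\max}T=u\}$ (rightmost operator applied first). Demazure--Lascoux operators on $\mathbb Z[\beta][x_1,\dots,x_n]$: $\partial_if=(f-s_if)/(x_i-x_{i+1})$ with $s_i$ swapping $x_i,x_{i+1}$, and $\varpi_if=\partial_i\big((x_i+\beta x_ix_{i+1})f\big)$. -}

module Defs where

open import Data.Bool using (Bool; true; false; if_then_else_; _∧_; not)
open import Data.Nat using (ℕ; zero; suc; _+_; _∸_; _≤_; _<_; _≡ᵇ_)
import Data.Nat.Properties as ℕP
open import Data.Integer using (ℤ) renaming (_+_ to _+ℤ_; _*_ to _*ℤ_; -_ to -ℤ_)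
import Data.Integer as ℤ
open import Data.Fin using (Fin; toℕ)
open import Data.Fin.Subset using (Subset; ⊥; _∈_; Nonempty; ∣_∣)
open import Data.Fin.Permutation using (Permutation′; _⟨$⟩ʳ_)
open import Data.Vec using (Vec; []; _∷_; toList; replicate; zipWith; tabulate; lookup)
import Data.Vec.Properties as VecP
open import Data.List using (List; []; _∷_; length; map; reverse; concatMap; foldr; _++_)
open import Data.List.Relation.Unary.All using (All)
open import Data.List.Relation.Unary.Unique.Propositional using (Unique)
import Data.List.Membership.Propositional as LMem
open import Data.Maybe using (Maybe; just; nothing)
open import Data.Product using (Σ; ∃; _×_; _,_)
open import Data.Product.Properties using (≡-dec)
open import Data.Sum using (_⊎_)
open import Data.Unit using (⊤)
open import Relation.Nullary using (yes; no)
open import Relation.Binary.PropositionalEquality using (_≡_)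
open import Relation.Binary.Construct.Closure.ReflexiveTransitive using (Star)
open import Relation.Binary.Construct.Closure.Symmetric using (SymClosure)
open import Function.Bundles using (_⇔_)

-- Conventions.
-- Letters 1..n and crystal indices i are natural numbers (1-based, as in
-- the paper).  A box is a subset of {1,..,n}, represented as
-- Subset n = Vec Bool n, where position (j-1) holds whether letter j is
-- in the box.  A 1×k row is a Vec of k boxes.

Box : ℕ → Set
Box n = Subset n

Row : ℕ → ℕ → Set
Row n k = Vec (Box n) k

has : ∀ {n} → Box n → ℕ → Bool
has []       _             = false
has (b ∷ bs) zero          = false
has (b ∷ bs) (suc zero)    = b
has (b ∷ bs) (suc (suc j)) = has bs (suc j)

setL : ∀ {n} → Box n → ℕ → Bool → Box n
setL []       _             v = []
setL (b ∷ bs) zero          v = b ∷ bs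
setL (b ∷ bs) (suc zero)    v = v ∷ bs
setL (b ∷ bs) (suc (suc j)) v = b ∷ setL bs (suc j) v

addL remL : ∀ {n} → ℕ → Box n → Box n
addL j A = setL A j true
remL j A = setL A j false

Weakly : ∀ {n k} → Row n k → Set
Weakly []           = ⊤
Weakly (A ∷ [])     = ⊤
Weakly (A ∷ B ∷ As) =
  (∀ x y → x ∈ A → y ∈ B → toℕ x ≤ toℕ y) × Weakly (B ∷ As)

AllNonempty : ∀ {n k} → Row n k → Set
AllNonempty []       = ⊤
AllNonempty (A ∷ As) = Nonempty A × AllNonempty As

SVT : ∀ {n k} → Row n k → Set
SVT T = AllNonempty T × Weakly T

u : (n k : ℕ) → Row n k
u n k = replicate k (addL 1 ⊥)

count : ∀ {n k} → Row n k → Fin n → ℕ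
count []       j = 0
count (A ∷ As) j = (if lookup A j then 1 else 0) + count As j

wt : ∀ {n k} → Row n k → Vec ℕ n
wt T = tabulate (count T)

ex : ∀ {n k} → Row n k → ℕ
ex []       = 0
ex (A ∷ As) = (∣ A ∣ ∸ 1) + ex As

getBox : ∀ {A : Set} {k} → Vec A k → ℕ → Maybe A
getBox []       _       = nothing
getBox (x ∷ xs) zero    = just x
getBox (x ∷ xs) (suc p) = getBox xs p

modifyAt : ∀ {A : Set} {k} → ℕ → (A → A) → Vec A k → Vec A k
modifyAt _       g []       = []
modifyAt zero    g (x ∷ xs) = g x ∷ xs
modifyAt (suc p) g (x ∷ xs) = x ∷ modifyAt p g xs

boxHas : ∀ {n k} → Row n k → ℕ → ℕ → Bool
boxHas T p j with getBox T p
... | nothing = false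
... | just A  = has A j

data Sign : Set where
  plus minus : Sign

signOf : ∀ {n} → ℕ → Box n → Maybe Sign
signOf i A with has A i | has A (suc i)
... | true  | false = just plus
... | false | true  = just minus
... | _     | _     = nothing

-- pushing a sign onto the (reversed) list of unmatched signs,
-- cancelling a pair "- +" (a - immediately followed by a +)
push : ℕ × Sign → List (ℕ × Sign) → List (ℕ × Sign)
push (p , plus)  ((q , minus) ∷ st) = st
push s           st                 = s ∷ st

scan : ∀ {n} → ℕ → ℕ → List (Box n) → List (ℕ × Sign) → List (ℕ × Sign)
scan i p []       st = reverse st
scan i p (A ∷ As) st with signOf i A
... | nothing = scan i (suc p) As st
... | just s  = scan i (suc p) As (push (p , s) st)

unmatched : ∀ {n k} → ℕ → Row n k → List (ℕ × Sign)
unmatched i T = scan i 0 (toList T) []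

rightmostPlus : List (ℕ × Sign) → Maybe ℕ
rightmostPlus []                = nothing
rightmostPlus ((p , plus) ∷ xs) with rightmostPlus xs
... | nothing = just p
... | just q  = just q
rightmostPlus ((p , minus) ∷ xs) = rightmostPlus xs

leftmostMinus : List (ℕ × Sign) → Maybe ℕ
leftmostMinus []                 = nothing
leftmostMinus ((p , minus) ∷ xs) = just p
leftmostMinus ((p , plus) ∷ xs)  = leftmostMinus xs

-- f_i ; nothing means 0.  (If b is the last box, "i ∉ b→" holds.)
f : ∀ {n k} → ℕ → Row n k → Maybe (Row n k)
f i T with rightmostPlus (unmatched i T)
... | nothing = nothing
... | just p with boxHas T (suc p) i
...   | false = just (modifyAt p (λ A → remL i (addL (suc i) A)) T)
...   | true  = just (modifyAt (suc p) (remL i) (modifyAt p (addL (suc i)) T))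

-- e_i ; nothing means 0.  (If b is the first box, "i+1 ∉ b←" holds.)
e : ∀ {n k} → ℕ → Row n k → Maybe (Row n k)
e i T with leftmostMinus (unmatched i T)
... | nothing = nothing
... | just zero = just (modifyAt zero (λ A → remL (suc i) (addL i A)) T)
... | just (suc q) with boxHas T q (suc i)
...   | false = just (modifyAt (suc q) (λ A → remL (suc i) (addL i A)) T)
...   | true  = just (modifyAt (suc q) (addL i) (modifyAt q (remL (suc i)) T))

anyBox : ∀ {n k} → (Box n → Bool) → Row n k → Bool
anyBox P []       = false
anyBox P (A ∷ As) = if P A then true else anyBox P As

rightmostPos : ∀ {n k} → (Box n → Bool) → ℕ → Row n k → Maybe ℕ
rightmostPos P p []       = nothing
rightmostPos P p (A ∷ As) with rightmostPos P (suc p) As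
... | just q  = just q
... | nothing = if P A then just p else nothing

leftmostPos : ∀ {n k} → (Box n → Bool) → ℕ → Row n k → Maybe ℕ
leftmostPos P p []       = nothing
leftmostPos P p (A ∷ As) = if P A then just p else leftmostPos P (suc p) As

fK : ∀ {n k} → ℕ → Row n k → Maybe (Row n k)
fK i T with anyBox (λ A → has A i) T | anyBox (λ A → has A (suc i)) T
... | true | false with rightmostPos (λ A → has A i) 0 T
...   | nothing = nothing
...   | just p  = just (modifyAt p (addL (suc i)) T)
fK i T | _ | _ = nothing

-- (in a row at most one box contains both i and i+1; we take the
-- leftmost such box)
eK : ∀ {n k} → ℕ → Row n k → Maybe (Row n k)
eK i T with leftmostPos (λ A → has A i ∧ has A (suc i)) 0 T
... | nothing = nothing
... | just p  = just (modifyAt p (remL (suc i)) T)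

ValidIndex : ℕ → ℕ → Set
ValidIndex n i = 1 ≤ i × i < n

Edge : (n k : ℕ) → Row n k → Row n k → Set
Edge n k T T' = SVT T × SVT T' ×
  (∃ λ i → ValidIndex n i × (f i T ≡ just T' ⊎ fK i T ≡ just T'))

Connected : (n k : ℕ) → Row n k → Row n k → Set
Connected n k = Star (SymClosure (Edge n k))

-- g^max, as in the paper: g^r T with r maximal such that g^r T ≠ 0

iter : ∀ {A : Set} → (A → Maybe A) → ℕ → A → Maybe A
iter g zero    x = just x
iter g (suc r) x with iter g r x
... | nothing = nothing
... | just y  = g y

Max : ∀ {A : Set} → (A → Maybe A) → A → A → Set
Max g T T' = Σ ℕ λ r → iter g r T ≡ just T' × g T' ≡ nothing

DemChain : ∀ {n k} → List ℕ → Row n k → Row n k → Set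
DemChain []       T T' = T ≡ T'
DemChain (i ∷ is) T T' =
  ∃ λ T₁ → ∃ λ T₂ → Max (e i) T T₁ × Max (eK i) T₁ T₂ × DemChain is T₂ T'

InDem : (n k : ℕ) → List ℕ → Row n k → Set
InDem n k word T = SVT T × DemChain word T (u n k)

sAct : ℕ → ℕ → ℕ
sAct i x = if x ≡ᵇ i then suc i else (if x ≡ᵇ suc i then i else x)

wordAct : List ℕ → ℕ → ℕ
wordAct []       x = x
wordAct (i ∷ is) x = sAct i (wordAct is x)

WordOf : (n : ℕ) → Permutation′ n → List ℕ → Set
WordOf n w word = All (ValidIndex n) word ×
  (∀ (x : Fin n) → wordAct word (suc (toℕ x)) ≡ suc (toℕ (w ⟨$⟩ʳ x)))

Reduced : (n : ℕ) → Permutation′ n → List ℕ → Set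
Reduced n w word = WordOf n w word ×
  (∀ word' → WordOf n w word' → length word ≤ length word')

-- Polynomials in ℤ[β][x₁,…,xₙ]
-- A monomial β^b x^a is (b , a); a polynomial is a finite list of terms,
-- and two polynomials are equal when all coefficients agree.

Mono : ℕ → Set
Mono n = ℕ × Vec ℕ n

Poly : ℕ → Set
Poly n = List (ℤ × Mono n)

coeff : ∀ {n} → Poly n → Mono n → ℤ
coeff []             m = ℤ.0ℤ
coeff ((c , m') ∷ p) m with ≡-dec ℕP._≟_ (VecP.≡-dec ℕP._≟_) m' m
... | yes _ = c +ℤ coeff p m
... | no  _ = coeff p m

_≈P_ : ∀ {n} → Poly n → Poly n → Set
p ≈P q = ∀ m → coeff p m ≡ coeff q m

_+P_ : ∀ {n} → Poly n → Poly n → Poly n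
p +P q = p ++ q

-P_ : ∀ {n} → Poly n → Poly n
-P p = map (λ { (c , m) → (-ℤ c , m) }) p

_-P_ : ∀ {n} → Poly n → Poly n → Poly n
p -P q = p +P (-P q)

mulMono : ∀ {n} → Mono n → Mono n → Mono n
mulMono (b , a) (b' , a') = (b + b' , zipWith _+_ a a')

_*P_ : ∀ {n} → Poly n → Poly n → Poly n
p *P q = concatMap (λ { (c , m) → map (λ { (c' , m') → (c *ℤ c' , mulMono m m') }) q }) p

getE : ∀ {n} → Vec ℕ n → ℕ → ℕ
getE []       _             = 0
getE (a ∷ as) zero          = 0
getE (a ∷ as) (suc zero)    = a
getE (a ∷ as) (suc (suc j)) = getE as (suc j)

setE : ∀ {n} → Vec ℕ n → ℕ → ℕ → Vec ℕ n
setE []       _             v = []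
setE (a ∷ as) zero          v = a ∷ as
setE (a ∷ as) (suc zero)    v = v ∷ as
setE (a ∷ as) (suc (suc j)) v = a ∷ setE as (suc j) v

swapE : ∀ {n} → ℕ → Vec ℕ n → Vec ℕ n
swapE i a = setE (setE a i (getE a (suc i))) (suc i) (getE a i)

sP : ∀ {n} → ℕ → Poly n → Poly n
sP i p = map (λ { (c , (b , a)) → (c , (b , swapE i a)) }) p

xPow : (n : ℕ) → ℕ → ℕ → Mono n
xPow n j d = (0 , setE (replicate n 0) j d)

βm : (n : ℕ) → Mono n
βm n = (1 , replicate n 0)

term : ∀ {n} → ℤ → Mono n → Poly n
term c m = (c , m) ∷ []

xDiff : (n : ℕ) → ℕ → Poly n
xDiff n i = term ℤ.1ℤ (xPow n i 1) +P term (-ℤ ℤ.1ℤ) (xPow n (suc i) 1)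

xLas : (n : ℕ) → ℕ → Poly n
xLas n i = term ℤ.1ℤ (xPow n i 1)
        +P term ℤ.1ℤ (mulMono (βm n) (mulMono (xPow n i 1) (xPow n (suc i) 1)))

-- Divided difference: IsDD n i p q  means  q = ∂_i p = (p - s_i p)/(x_i - x_{i+1}),
-- i.e. q is the polynomial with (x_i - x_{i+1}) q = p - s_i p.
IsDD : (n : ℕ) → ℕ → Poly n → Poly n → Set
IsDD n i p q = (xDiff n i *P q) ≈P (p -P sP i p)

IsVarpi : (n : ℕ) → ℕ → Poly n → Poly n → Set
IsVarpi n i p q = IsDD n i (xLas n i *P p) q

VarpiChain : (n : ℕ) → List ℕ → Poly n → Poly n → Set
VarpiChain n []       p q = q ≡ p
VarpiChain n (i ∷ is) p q = ∃ λ r → VarpiChain n is p r × IsVarpi n i r q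

genFun : ∀ {n k} → List (Row n k) → Poly n
genFun []       = []
genFun (T ∷ Ts) = (ℤ.1ℤ , (ex T , wt T)) ∷ genFun Ts

Enumerates : ∀ {A : Set} → List A → (A → Set) → Set
Enumerates L P = Unique L × (∀ T → (T LMem.∈ L) ⇔ P T)

oneℤ : ℤ
oneℤ = ℤ.1ℤ

{-# OPTIONS --safe #-}

-- In one row the i-signature is a block of + followed by a block of −, so nothing cancels, and
-- applying e_i and then e_i^K as often as possible amounts to replacing the letter i + 1 by i in
-- every box.  Hence T lies in the Demazure crystal of a word exactly when the composite of these
-- replacements sends all letters of T to 1, that is, when the letters of T are bounded by a
-- number r depending on the word; for a reduced word of w, an exchange argument gives r = w(1).
--
-- For the character, the rows with letters at most the new bound are the disjoint union, over the
-- rows T₀ with letters at most the old bound and without the letter i + 1, of the fibres of the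
-- replacement.  By induction on the row, the generating function F of the fibre of T₀ is
-- s_i-invariant and equals ϖ_i of the monomial of T₀.  If the bound is i, all rows lack i + 1 and
-- the sum over T₀ is ϖ_i of the old generating function.  Otherwise the bound does not change, and
-- the generating function, a sum of s_i-invariant F, is fixed by ϖ_i.

module Submission where

open import Defs
open import Algebra.Bundles using (CommutativeMonoid)
import Algebra.Solver.CommutativeMonoid as MonoSolver
open import Data.Bool using (Bool; T; true; false; if_then_else_; _∧_; not)
import Data.Bool.Properties as BoolP
open import Data.Empty using (⊥-elim)
open import Data.Fin using (Fin; toℕ; zero; suc)
open import Data.Fin.Permutation using (Permutation′; _⟨$⟩ʳ_)
open import Data.Fin.Subset using (_∈_; ∣_∣; ⊥)
open import Data.Fin.Subset.Properties using (∣⊥∣≡0)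
open import Data.Integer as ℤ using (ℤ)
import Data.Integer.Properties as ℤP
open import Data.Integer.Tactic.RingSolver using (solve-∀)
open import Data.List using (List; []; _∷_; reverse; _++_; length; map; concatMap; filter)
import Data.List.Membership.Propositional as LMem
import Data.List.Membership.Propositional.Properties as LMemP
open import Data.List.Membership.Propositional.Properties.WithK using (unique∧set⇒bag)
import Data.List.Properties as ListP
open import Data.List.Relation.Binary.BagAndSetEquality using (∼bag⇒↭)
open import Data.List.Relation.Binary.Permutation.Propositional as ↭ using (_↭_)
import Data.List.Relation.Unary.All as LAll
import Data.List.Relation.Unary.All.Properties as LAllP
import Data.List.Relation.Unary.AllPairs as AP
import Data.List.Relation.Unary.Any as LAny
open import Data.List.Relation.Unary.Unique.Propositional using (Unique)
import Data.List.Relation.Unary.Unique.Propositional.Properties as UniqueP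
open import Data.Maybe using (Maybe; just; nothing)
open import Data.Nat using (ℕ; zero; suc; _+_; _∸_; _≤_; _<_; z≤n; s≤s; _≟_; _≡ᵇ_)
import Data.Nat.Properties as ℕP
open import Data.Product using (∃; _×_; _,_; proj₁; proj₂)
open import Data.Product.Properties using (≡-dec)
open import Data.Sum using (_⊎_; inj₁; inj₂)
open import Data.Unit using (⊤; tt)
open import Data.Vec as Vec using (Vec; []; _∷_; toList; replicate; lookup; here; there; zipWith; tabulate)
import Data.Vec.Properties as VecP
open import Data.Vec.Relation.Unary.All as VAll using (All; []; _∷_)
open import Function using (_∘_; case_of_)
open import Function.Bundles using (_⇔_; mk⇔; Equivalence)
open import Relation.Binary.Construct.Closure.ReflexiveTransitive as Star using (ε; _◅_; _◅◅_)
open import Relation.Binary.Construct.Closure.Symmetric as Sym using (bwd)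
open import Relation.Binary.Definitions using (tri<; tri≈; tri>)
open import Relation.Binary.PropositionalEquality
open import Relation.Nullary using (¬_; Dec; yes; no)

-- Letters of a box

-- The order of a row enters mainly through one remark: once a box contains i + 1, all later boxes
-- lack i. It gives the sign pattern, it leaves at most one box with both letters when e_i is
-- exhausted, and it forces the boxes raised from i to i + 1 in a fibre to be a final segment of
-- those of T₀ that contain i, where the first raised box may also keep i. With m boxes of T₀
-- containing i, the fibre thus has 2m + 1 rows, and up to an s_i-invariant factor its sum is h_m +
-- β x_i x_{i+1} h_{m-1} in the variables x_i, x_{i+1}, which is ϖ_i of x_i^m. A divided difference
-- is only specified by its product with x_i - x_{i+1}. The fibre identity is therefore proved in
-- multiplied form, and s_i-invariance is a second induction that uses this identity instead of
-- dividing it. For reduced words the obstacle is that pulling a bound back along a merge never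
-- lowers it, whereas s_i lowers w(1) when w(1) = i + 1. Minimal length excludes exactly this case.

has-setL-same : ∀ {n} (A : Box n) j v → 1 ≤ j → j ≤ n → has (setL A j v) j ≡ v
has-setL-same (b ∷ A) (suc zero)    v _ _        = refl
has-setL-same (b ∷ A) (suc (suc j)) v _ (s≤s le) = has-setL-same A (suc j) v (s≤s z≤n) le

has-setL-other : ∀ {n} (A : Box n) j v x → x ≢ j → has (setL A j v) x ≡ has A x
has-setL-other []      j             v x             x≢j = refl
has-setL-other (b ∷ A) zero          v x             x≢j = refl
has-setL-other (b ∷ A) (suc zero)    v zero          x≢j = refl
has-setL-other (b ∷ A) (suc zero)    v (suc zero)    x≢j = ⊥-elim (x≢j refl)
has-setL-other (b ∷ A) (suc zero)    v (suc (suc x)) x≢j = refl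
has-setL-other (b ∷ A) (suc (suc j)) v zero          x≢j = refl
has-setL-other (b ∷ A) (suc (suc j)) v (suc zero)    x≢j = refl
has-setL-other (b ∷ A) (suc (suc j)) v (suc (suc x)) x≢j =
  has-setL-other A (suc j) v (suc x) (x≢j ∘ cong suc)

setL-id : ∀ {n} (A : Box n) j {v} → has A j ≡ v → setL A j v ≡ A
setL-id []      j             eq   = refl
setL-id (b ∷ A) zero          eq   = refl
setL-id (b ∷ A) (suc zero)    refl = refl
setL-id (b ∷ A) (suc (suc j)) eq   = cong (b ∷_) (setL-id A (suc j) eq)

setL-setL : ∀ {n} (A : Box n) j {v w} → setL (setL A j v) j w ≡ setL A j w
setL-setL []      j             = refl
setL-setL (b ∷ A) zero          = refl
setL-setL (b ∷ A) (suc zero)    = refl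
setL-setL (b ∷ A) (suc (suc j)) = cong (b ∷_) (setL-setL A (suc j))

setL-comm : ∀ {n} (A : Box n) i j {v w} → i ≢ j →
            setL (setL A i v) j w ≡ setL (setL A j w) i v
setL-comm []      i             j             i≢j = refl
setL-comm (b ∷ A) zero          zero          i≢j = refl
setL-comm (b ∷ A) zero          (suc zero)    i≢j = refl
setL-comm (b ∷ A) zero          (suc (suc j)) i≢j = refl
setL-comm (b ∷ A) (suc zero)    zero          i≢j = refl
setL-comm (b ∷ A) (suc (suc i)) zero          i≢j = refl
setL-comm (b ∷ A) (suc zero)    (suc zero)    i≢j = ⊥-elim (i≢j refl)
setL-comm (b ∷ A) (suc zero)    (suc (suc j)) i≢j = refl
setL-comm (b ∷ A) (suc (suc i)) (suc zero)    i≢j = refl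
setL-comm (b ∷ A) (suc (suc i)) (suc (suc j)) i≢j =
  cong (b ∷_) (setL-comm A (suc i) (suc j) (i≢j ∘ cong suc))

has-bound : ∀ {n} (A : Box n) x → has A x ≡ true → 1 ≤ x × x ≤ n
has-bound (b ∷ A) (suc zero)    h = s≤s z≤n , s≤s z≤n
has-bound (b ∷ A) (suc (suc x)) h = s≤s z≤n , s≤s (proj₂ (has-bound A (suc x) h))

∈⇒has : ∀ {n} {A : Box n} {x} → x ∈ A → has A (suc (toℕ x)) ≡ true
∈⇒has here      = refl
∈⇒has (there p) = ∈⇒has p

has⇒∈ : ∀ {n} (A : Box n) y → has A y ≡ true → ∃ λ x → suc (toℕ x) ≡ y × x ∈ A
has⇒∈ (b ∷ A) (suc zero)    refl = zero , refl , here
has⇒∈ (b ∷ A) (suc (suc y)) h    with has⇒∈ A (suc y) h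
... | x , eq , x∈A = suc x , cong suc eq , there x∈A

clash : ∀ {b : Bool} {X : Set} → b ≡ true → b ≡ false → X
clash refl ()

has-ext : ∀ {n} (A B : Box n) → (∀ x → has A x ≡ has B x) → A ≡ B
has-ext []      []      eq = refl
has-ext (a ∷ A) (b ∷ B) eq = cong₂ _∷_ (eq 1) (has-ext A B tail-eq)
  where
  tail-eq : ∀ x → has A x ≡ has B x
  tail-eq zero    = trans (has-zero A) (sym (has-zero B))
    where
    has-zero : ∀ {n} (A : Box n) → has A 0 ≡ false
    has-zero []      = refl
    has-zero (a ∷ A) = refl
  tail-eq (suc x) = eq (suc (suc x))

has-⊥ : ∀ n x → has (⊥ {n}) x ≡ false
has-⊥ zero    x             = refl
has-⊥ (suc n) zero          = refl
has-⊥ (suc n) (suc zero)    = refl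
has-⊥ (suc n) (suc (suc x)) = has-⊥ n (suc x)

-- Rows whose boxes are compared pairwise, not only with their neighbours

infix 4 _≼_

_≼_ : ∀ {n} → Box n → Box n → Set
A ≼ B = ∀ x y → has A x ≡ true → has B y ≡ true → x ≤ y

Inhabited : ∀ {n} → Box n → Set
Inhabited A = ∃ λ x → has A x ≡ true

-- Comparing the head with all later boxes lets one letter of the head restrict the whole tail at
-- once, as in `lacks-above`.
Ascending : ∀ {n k} → Row n k → Set
Ascending []       = ⊤
Ascending (A ∷ As) = Inhabited A × All (A ≼_) As × Ascending As

Lacks : ∀ {n k} → ℕ → Row n k → Set
Lacks x = All (λ A → has A x ≡ false)

SVT⇒Ascending : ∀ {n k} (T : Row n k) → SVT T → Ascending T
SVT⇒Ascending []           _ = tt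
SVT⇒Ascending (A ∷ [])     (((x , x∈A) , _) , _) = (_ , ∈⇒has x∈A) , [] , tt
SVT⇒Ascending (A ∷ B ∷ As) (((x , x∈A) , neB , neAs) , A≤B , ws)
  with SVT⇒Ascending (B ∷ As) ((neB , neAs) , ws)
... | (y , y∈B) , B≼As , as =
  (_ , ∈⇒has x∈A) , A≼B ∷ VAll.map (λ {C} → through-B {C}) B≼As , (y , y∈B) , B≼As , as
  where
  A≼B : A ≼ B
  A≼B x y hx hy with has⇒∈ A x hx | has⇒∈ B y hy
  ... | _ , refl , x∈A | _ , refl , y∈B = s≤s (A≤B _ _ x∈A y∈B)
  -- `≼` holds vacuously for an empty box, so it is transitive only through an inhabited one; the
  -- letter `y` of `B` is the link.
  through-B : ∀ {C} → B ≼ C → A ≼ C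
  through-B B≼C x z hx hz = ℕP.≤-trans (A≼B x y hx y∈B) (B≼C y z y∈B hz)

Ascending⇒SVT : ∀ {n k} (T : Row n k) → Ascending T → SVT T
Ascending⇒SVT []           _ = tt , tt
Ascending⇒SVT (A ∷ [])     ((x , x∈A) , _) with has⇒∈ A x x∈A
... | _ , _ , m = ((_ , m) , tt) , tt
Ascending⇒SVT (A ∷ B ∷ As) ((x , x∈A) , A≼B ∷ _ , as) with has⇒∈ A x x∈A | Ascending⇒SVT (B ∷ As) as
... | _ , _ , m | ne , w =
  ((_ , m) , ne) , (λ x y p q → ℕP.≤-pred (A≼B _ _ (∈⇒has p) (∈⇒has q))) , w

-- Bracketing

module _ (i : ℕ) where

  signOf-plus : ∀ {n} (A : Box n) → has A i ≡ true → has A (suc i) ≡ false → signOf i A ≡ just plus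
  signOf-plus A p q rewrite p | q = refl

  signOf-minus : ∀ {n} (A : Box n) → has A i ≡ false → has A (suc i) ≡ true → signOf i A ≡ just minus
  signOf-minus A p q rewrite p | q = refl

  signOf-both : ∀ {n} (A : Box n) → has A i ≡ true → has A (suc i) ≡ true → signOf i A ≡ nothing
  signOf-both A p q rewrite p | q = refl

  signOf≢plus : ∀ {n} (A : Box n) → has A i ≡ false → signOf i A ≢ just plus
  signOf≢plus A p rewrite p with has A (suc i)
  ... | true  = λ ()
  ... | false = λ ()

  signOf≢minus : ∀ {n} (A : Box n) → (has A (suc i) ≡ true → has A i ≡ true) → signOf i A ≢ just minus
  signOf≢minus A p with has A i | has A (suc i)
  ... | true  | true  = λ ()
  ... | true  | false = λ ()
  ... | false | true  = case p refl of λ ()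
  ... | false | false = λ ()

  signs : ∀ {n k} → ℕ → Row n k → List (ℕ × Sign)
  signs p []       = []
  signs p (A ∷ As) with signOf i A
  ... | nothing = signs (suc p) As
  ... | just s  = (p , s) ∷ signs (suc p) As

  -- The invariant that no - stands before a +. Along `low` boxes the stack of the scan holds only
  -- +; from the box at `high` on, whatever its own sign, no further + can arrive.
  data NoPair {n} : ∀ {k} → Row n k → Set where
    []   : NoPair []
    low  : ∀ {k A} {As : Row n k} → signOf i A ≢ just minus → NoPair As → NoPair (A ∷ As)
    high : ∀ {k A} {As : Row n k} → Lacks i As → NoPair (A ∷ As)

  Pluses : List (ℕ × Sign) → Set
  Pluses = LAll.All (λ x → proj₂ x ≡ plus)

  push-plus : ∀ p {st} → Pluses st → push (p , plus) st ≡ (p , plus) ∷ st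
  push-plus p LAll.[]          = refl
  push-plus p (refl LAll.∷ ps) = refl

  reverse-∷-++ : ∀ {A : Set} (x : A) st xs → reverse (x ∷ st) ++ xs ≡ reverse st ++ x ∷ xs
  reverse-∷-++ x st xs = trans (cong (_++ xs) (ListP.unfold-reverse x st)) (ListP.∷ʳ-++ (reverse st) x xs)

  -- `push` cancels only when a + arrives, and boxes without i never supply one, so the stack may be
  -- arbitrary.
  scan-high : ∀ {n k} p (T : Row n k) st → Lacks i T → scan i p (toList T) st ≡ reverse st ++ signs p T
  scan-high p []       st []       = sym (ListP.++-identityʳ _)
  scan-high p (A ∷ As) st (l ∷ ls) with signOf i A | signOf≢plus A l
  ... | nothing    | _  = scan-high (suc p) As st ls
  ... | just plus  | np = ⊥-elim (np refl)
  ... | just minus | _  =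
    trans (scan-high (suc p) As _ ls) (reverse-∷-++ (p , minus) st _)

  scan-NoPair : ∀ {n k} p {T : Row n k} {st} → Pluses st → NoPair T →
                scan i p (toList T) st ≡ reverse st ++ signs p T
  scan-NoPair p ps [] = sym (ListP.++-identityʳ _)
  scan-NoPair p {A ∷ As} {st} ps (low nm np) with signOf i A
  ... | nothing    = scan-NoPair (suc p) ps np
  ... | just minus = ⊥-elim (nm refl)
  ... | just plus rewrite push-plus p ps =
    trans (scan-NoPair (suc p) (refl LAll.∷ ps) np) (reverse-∷-++ (p , plus) st _)
  scan-NoPair p {A ∷ As} {st} ps (high ls) with signOf i A
  ... | nothing    = scan-high (suc p) As st ls
  ... | just minus = trans (scan-high (suc p) As _ ls) (reverse-∷-++ (p , minus) st _)
  ... | just plus rewrite push-plus p ps =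
    trans (scan-high (suc p) As _ ls) (reverse-∷-++ (p , plus) st _)

  unmatched-signs : ∀ {n k} {T : Row n k} → NoPair T → unmatched i T ≡ signs 0 T
  unmatched-signs np = scan-NoPair 0 LAll.[] np

  rightmostPlus-∷ : ∀ x {xs q} → rightmostPlus xs ≡ just q → rightmostPlus (x ∷ xs) ≡ just q
  rightmostPlus-∷ (p , plus)  eq rewrite eq = refl
  rightmostPlus-∷ (p , minus) eq = eq

  rightmostPlus-Lacks : ∀ {n k} p {T : Row n k} → Lacks i T → rightmostPlus (signs p T) ≡ nothing
  rightmostPlus-Lacks p [] = refl
  rightmostPlus-Lacks p {A ∷ As} (l ∷ ls) with signOf i A | signOf≢plus A l
  ... | nothing    | _  = rightmostPlus-Lacks (suc p) ls
  ... | just plus  | np = ⊥-elim (np refl)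
  ... | just minus | _  = rightmostPlus-Lacks (suc p) ls

  rightmostPlus-here : ∀ {n k} p (A : Box n) {As : Row n k} → signOf i A ≡ just plus →
    rightmostPlus (signs (suc p) As) ≡ nothing → rightmostPlus (signs p (A ∷ As)) ≡ just p
  rightmostPlus-here p A eq eq′ rewrite eq | eq′ = refl

  rightmostPlus-there : ∀ {n k} p (A : Box n) {As : Row n k} {q} →
    rightmostPlus (signs (suc p) As) ≡ just q → rightmostPlus (signs p (A ∷ As)) ≡ just q
  rightmostPlus-there p A eq with signOf i A
  ... | nothing = eq
  ... | just s  = rightmostPlus-∷ (p , s) eq

  leftmostMinus-here : ∀ {n k} p (A : Box n) {As : Row n k} → signOf i A ≡ just minus →
    leftmostMinus (signs p (A ∷ As)) ≡ just p
  leftmostMinus-here p A eq rewrite eq = refl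

  leftmostMinus-there : ∀ {n k} p (A : Box n) {As : Row n k} → signOf i A ≢ just minus →
    leftmostMinus (signs p (A ∷ As)) ≡ leftmostMinus (signs (suc p) As)
  leftmostMinus-there p A nm with signOf i A
  ... | nothing    = refl
  ... | just plus  = refl
  ... | just minus = ⊥-elim (nm refl)

  -- The effect of e_i and f_i once the position is known, separated from the bracketing so that it
  -- can be followed by induction when a box is prepended.
  eAt fAt : ∀ {n k} → ℕ → Row n k → Maybe (Row n k)
  eAt zero    T = just (modifyAt zero (λ A → remL (suc i) (addL i A)) T)
  eAt (suc q) T = if boxHas T q (suc i)
    then just (modifyAt (suc q) (addL i) (modifyAt q (remL (suc i)) T))
    else just (modifyAt (suc q) (λ A → remL (suc i) (addL i A)) T)
  fAt p T = if boxHas T (suc p) i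
    then just (modifyAt (suc p) (remL i) (modifyAt p (addL (suc i)) T))
    else just (modifyAt p (λ A → remL i (addL (suc i) A)) T)

  e-eAt : ∀ {n k} p {T : Row n k} → leftmostMinus (unmatched i T) ≡ just p → e i T ≡ eAt p T
  e-eAt zero        eq rewrite eq = refl
  e-eAt (suc q) {T} eq rewrite eq with boxHas T q (suc i)
  ... | true  = refl
  ... | false = refl

  e-nothing : ∀ {n k} {T : Row n k} → leftmostMinus (unmatched i T) ≡ nothing → e i T ≡ nothing
  e-nothing eq rewrite eq = refl

  f-fAt : ∀ {n k} p {T : Row n k} → rightmostPlus (unmatched i T) ≡ just p → f i T ≡ fAt p T
  f-fAt p {T} eq rewrite eq with boxHas T (suc p) i
  ... | true  = refl
  ... | false = refl

  boxHas-∷ : ∀ {n k} (A : Box n) (As : Row n k) q x → boxHas (A ∷ As) (suc q) x ≡ boxHas As q x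
  boxHas-∷ A As q x with getBox As q
  ... | nothing = refl
  ... | just _  = refl

  if-just-∷ : ∀ {X : Set} {k} {b c} (x : X) {xs ys zs : Vec X k} → b ≡ c →
              (if c then just xs else just ys) ≡ just zs →
              (if b then just (x ∷ xs) else just (x ∷ ys)) ≡ just (x ∷ zs)
  if-just-∷ {b = true}  x refl refl = refl
  if-just-∷ {b = false} x refl refl = refl

  eAt-∷ : ∀ {n k} p (A : Box n) (As : Row n k) {T′} → has A (suc i) ≡ false →
          eAt p As ≡ just T′ → eAt (suc p) (A ∷ As) ≡ just (A ∷ T′)
  -- At position 0 there is no left neighbour to inspect; after prepending, `A` is that neighbour,
  -- and its lack of i + 1 selects the replacing branch again.
  eAt-∷ zero    A As h refl rewrite h = refl
  eAt-∷ (suc q) A As h eq   = if-just-∷ A (boxHas-∷ A As q (suc i)) eq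

  fAt-∷ : ∀ {n k} p (A : Box n) (As : Row n k) {T′} →
          fAt p As ≡ just T′ → fAt (suc p) (A ∷ As) ≡ just (A ∷ T′)
  fAt-∷ p A As eq = if-just-∷ A (boxHas-∷ A As (suc p) i) eq

has? : ∀ {n} (A : Box n) x → has A x ≡ true ⊎ has A x ≡ false
has? A x with has A x
... | true  = inj₁ refl
... | false = inj₂ refl

i≢j : {i : ℕ} → i ≢ suc i
i≢j ()

j≢i : {i : ℕ} → suc i ≢ i
j≢i ()

-- Merging the letter i + 1 into i

merge raise : ∀ {n} → ℕ → Box n → Box n
merge i A = if has A (suc i) then remL (suc i) (addL i A) else A
raise i A = if has A i then remL i (addL (suc i) A) else A

mergeRow raiseRow : ∀ {n k} → ℕ → Row n k → Row n k
mergeRow i = Vec.map (merge i)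
raiseRow i = Vec.map (raise i)

merge-≡ : ∀ {n i} (A : Box n) → has A (suc i) ≡ true → merge i A ≡ remL (suc i) (addL i A)
merge-≡ A h rewrite h = refl

merge-Lacks : ∀ {n i} (A : Box n) → has A (suc i) ≡ false → merge i A ≡ A
merge-Lacks A h rewrite h = refl

mergeRow-Lacks : ∀ {n i k} {T : Row n k} → Lacks (suc i) T → mergeRow i T ≡ T
mergeRow-Lacks []       = refl
mergeRow-Lacks {T = A ∷ _} (l ∷ ls) = cong₂ _∷_ (merge-Lacks A l) (mergeRow-Lacks ls)

module _ {n : ℕ} {x : ℕ} (1≤x : 1 ≤ x) (x≤n : x ≤ n) where

  has-addL : (A : Box n) → has (addL x A) x ≡ true
  has-addL A = has-setL-same A x true 1≤x x≤n

  has-remL : (A : Box n) → has (remL x A) x ≡ false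
  has-remL A = has-setL-same A x false 1≤x x≤n

  addL-inv : (A : Box n) → ∀ {y} → has (addL x A) y ≡ true → y ≡ x ⊎ has A y ≡ true
  addL-inv A {y} h with y ≟ x
  ... | yes eq = inj₁ eq
  ... | no neq = inj₂ (trans (sym (has-setL-other A x true y neq)) h)

  addL-mono : (A : Box n) → ∀ {y} → has A y ≡ true → has (addL x A) y ≡ true
  addL-mono A {y} h with y ≟ x
  ... | yes refl = has-addL A
  ... | no neq   = trans (has-setL-other A x true y neq) h

  remL-inv : (A : Box n) → ∀ {y} → has (remL x A) y ≡ true → y ≢ x × has A y ≡ true
  remL-inv A {y} h with y ≟ x
  ... | yes refl = clash h (has-remL A)
  ... | no neq   = neq , trans (sym (has-setL-other A x false y neq)) h

  remL-keep : (A : Box n) → ∀ {y} → y ≢ x → has A y ≡ true → has (remL x A) y ≡ true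
  remL-keep A {y} neq h = trans (has-setL-other A x false y neq) h

-- With x = i and y = i + 1 this is the reason that no + follows a box containing i + 1.
lacks-above : ∀ {n k x y} (A : Box n) {As : Row n k} → x < y → has A y ≡ true →
              All (A ≼_) As → Lacks x As
lacks-above {x = x} {y} A x<y h = VAll.map λ {C} A≼C → case has? C x of λ where
  (inj₁ t) → ⊥-elim (ℕP.<⇒≱ x<y (A≼C y x h t))
  (inj₂ f) → f

≤∧≢suc : ∀ {x i} → x ≤ suc i → x ≢ suc i → x ≤ i
≤∧≢suc le ne = ℕP.≤-pred (ℕP.≤∧≢⇒< le ne)

-- Edges of the crystal

-- `iter` adds the new application at the end, while an induction along a path peels off the first
-- step; this reconciles the two.
iter-suc : ∀ {A : Set} (g : A → Maybe A) r {x y} → g x ≡ just y → iter g (suc r) x ≡ iter g r y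
iter-suc g zero    eq = eq
iter-suc g (suc r) {x} eq with iter g (suc r) x | iter-suc g r eq
... | _ | refl = refl

Max-refl : ∀ {A : Set} {g : A → Maybe A} {x} → g x ≡ nothing → Max g x x
Max-refl eq = 0 , refl , eq

Max-step : ∀ {A : Set} {g : A → Maybe A} {x y z} → g x ≡ just y → Max g y z → Max g x z
Max-step {g = g} eq (r , it , end) = suc r , trans (iter-suc g r eq) it , end

iter-nothing : ∀ {A : Set} (g : A → Maybe A) r {x} → g x ≡ nothing → iter g (suc r) x ≡ nothing
iter-nothing g zero    eq = eq
iter-nothing g (suc r) {x} eq with iter g (suc r) x | iter-nothing g r eq
... | _ | refl = refl

Max-unique : ∀ {A : Set} {g : A → Maybe A} {x y z} → Max g x y → Max g x z → y ≡ z
Max-unique {g = g} (r , it , end) (r′ , it′ , end′) = go r r′ it end it′ end′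
  where
  go : ∀ r r′ {x y z} → iter g r x ≡ just y → g y ≡ nothing → iter g r′ x ≡ just z → g z ≡ nothing → y ≡ z
  go zero    zero     refl end refl end′ = refl
  go zero    (suc r′) refl end it′  end′ = case trans (sym (iter-nothing g r′ end)) it′ of λ ()
  go (suc r) zero     it   end refl end′ = case trans (sym (iter-nothing g r end′)) it of λ ()
  go (suc r) (suc r′) {x} it end it′ end′ with g x in eq
  ... | nothing = case trans (sym (iter-nothing g r eq)) it of λ ()
  ... | just y  = go r r′ (trans (sym (iter-suc g r eq)) it) end
                          (trans (sym (iter-suc g r′ eq)) it′) end′

module Index {n i : ℕ} (valid : ValidIndex n i) where

  1≤i : 1 ≤ i
  1≤i = proj₁ valid

  i≤n : i ≤ n
  i≤n = ℕP.<⇒≤ (proj₂ valid)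

  1≤j : 1 ≤ suc i
  1≤j = s≤s z≤n

  j≤n : suc i ≤ n
  j≤n = proj₂ valid

module _ {n : ℕ} (i : ℕ) (valid : ValidIndex n i) where

  open Index valid

  private
    j = suc i

    hasj-addi : (A : Box n) → has (addL i A) j ≡ has A j
    hasj-addi A = has-setL-other A i true j j≢i

    hasi-remj : (A : Box n) → has (remL j A) i ≡ has A i
    hasi-remj A = has-setL-other A j false i i≢j

  lower : Box n → Box n
  lower A = remL j (addL i A)

  hasi-lower : (A : Box n) → has (lower A) i ≡ true
  hasi-lower A = trans (hasi-remj (addL i A)) (has-addL 1≤i i≤n A)

  hasj-lower : (A : Box n) → has (lower A) j ≡ false
  hasj-lower A = has-remL 1≤j j≤n (addL i A)

  lower-inv : (A : Box n) → ∀ {x} → has (lower A) x ≡ true → x ≢ j × (x ≡ i ⊎ has A x ≡ true)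
  lower-inv A h with remL-inv 1≤j j≤n (addL i A) h
  ... | neq , h′ = neq , addL-inv 1≤i i≤n A h′

  lower-mono : (A : Box n) → ∀ {x} → x ≢ j → has A x ≡ true → has (lower A) x ≡ true
  lower-mono A x≢j h = remL-keep 1≤j j≤n (addL i A) x≢j (addL-mono 1≤i i≤n A h)

  merge-Lacksj : (A : Box n) → has (merge i A) j ≡ false
  merge-Lacksj A with has A j in eq
  ... | true  = hasj-lower A
  ... | false = eq

  -- The branches of e_i, read from the left up to the first box with i + 1. If that box lacks i, it
  -- carries the leftmost - (`turn`). If it contains both letters it has no sign, and the leftmost -
  -- can only be over its right neighbour (`pass`).
  data EStep : ∀ {k} → Row n k → Row n k → Set where
    there : ∀ {k A} {As As′ : Row n k} → has A j ≡ false → EStep As As′ → EStep (A ∷ As) (A ∷ As′)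
    turn  : ∀ {k A} {As : Row n k} → has A i ≡ false → has A j ≡ true → Lacks i As →
            EStep (A ∷ As) (lower A ∷ As)
    pass  : ∀ {k A C} {As : Row n k} → has A i ≡ true → has A j ≡ true →
            has C i ≡ false → has C j ≡ true → Lacks i As →
            EStep (A ∷ C ∷ As) (remL j A ∷ addL i C ∷ As)

  NoMinus : ∀ {k} → Row n k → Set
  NoMinus = All (λ A → has A j ≡ true → has A i ≡ true)

  NoMinus⇒NoPair : ∀ {k} {T : Row n k} → NoMinus T → NoPair i T
  NoMinus⇒NoPair []                 = []
  NoMinus⇒NoPair {T = A ∷ _} (h ∷ hs) = low (signOf≢minus i A h) (NoMinus⇒NoPair hs)

  leftmostMinus-NoMinus : ∀ {k} p {T : Row n k} → NoMinus T → leftmostMinus (signs i p T) ≡ nothing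
  leftmostMinus-NoMinus p []       = refl
  leftmostMinus-NoMinus p {A ∷ _} (h ∷ hs) =
    trans (leftmostMinus-there i p A (signOf≢minus i A h)) (leftmostMinus-NoMinus (suc p) hs)

  NoMinus⇒e-nothing : ∀ {k} {T : Row n k} → NoMinus T → e i T ≡ nothing
  NoMinus⇒e-nothing {T = T} nm = e-nothing i {T = T}
    (trans (cong leftmostMinus (unmatched-signs i (NoMinus⇒NoPair nm))) (leftmostMinus-NoMinus 0 nm))

  Lacks⇒NoMinus : ∀ {k} {T : Row n k} → Lacks j T → NoMinus T
  Lacks⇒NoMinus []       = []
  Lacks⇒NoMinus (f ∷ fs) = (λ t → clash t f) ∷ Lacks⇒NoMinus fs

  lacksj⇒≢minus : ∀ (A : Box n) → has A j ≡ false → signOf i A ≢ just minus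
  lacksj⇒≢minus A f = signOf≢minus i A (λ t → clash t f)

  EStep⇒NoPair : ∀ {k} {T T′ : Row n k} → EStep T T′ → NoPair i T
  EStep⇒NoPair (there {A = A} f s) = low (lacksj⇒≢minus A f) (EStep⇒NoPair s)
  EStep⇒NoPair (turn f t ls)      = high ls
  EStep⇒NoPair (pass {A = A} t t′ f t″ ls) = low (signOf≢minus i A (λ _ → t)) (high ls)

  EStep⇒NoPair′ : ∀ {k} {T T′ : Row n k} → EStep T T′ → NoPair i T′
  EStep⇒NoPair′ (there {A = A} f s) = low (lacksj⇒≢minus A f) (EStep⇒NoPair′ s)
  EStep⇒NoPair′ (turn f t ls)      = high ls
  EStep⇒NoPair′ (pass {A = A} t t′ f t″ ls) =
    low (lacksj⇒≢minus (remL j A) (has-remL 1≤j j≤n A)) (high ls)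

  -- The two positions differ for `pass`: e_i acts at the - over the right box, whereas the + that
  -- f_i finds afterwards is over the left box, which has lost i + 1.
  ePos fPos : ∀ {k} {T T′ : Row n k} → EStep T T′ → ℕ
  ePos (there _ s)        = suc (ePos s)
  ePos (turn _ _ _)       = 0
  ePos (pass _ _ _ _ _)   = 1
  fPos (there _ s)        = suc (fPos s)
  fPos (turn _ _ _)       = 0
  fPos (pass _ _ _ _ _)   = 0

  leftmostMinus-EStep : ∀ {k} {T T′ : Row n k} q (s : EStep T T′) →
                        leftmostMinus (signs i q T) ≡ just (ePos s + q)
  leftmostMinus-EStep q (there {A = A} f s) = begin
    _                      ≡⟨ leftmostMinus-there i q A (lacksj⇒≢minus A f) ⟩
    _                      ≡⟨ leftmostMinus-EStep (suc q) s ⟩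
    just (ePos s + suc q)  ≡⟨ cong just (ℕP.+-suc (ePos s) q) ⟩
    just (suc (ePos s) + q) ∎ where open ≡-Reasoning
  leftmostMinus-EStep q (turn {A = A} f t _) = leftmostMinus-here i q A (signOf-minus i A f t)
  leftmostMinus-EStep q (pass {A = A} {C} t t′ f t″ _) =
    trans (leftmostMinus-there i q A (signOf≢minus i A (λ _ → t)))
          (leftmostMinus-here i (suc q) C (signOf-minus i C f t″))

  rightmostPlus-EStep : ∀ {k} {T T′ : Row n k} q (s : EStep T T′) →
                        rightmostPlus (signs i q T′) ≡ just (fPos s + q)
  rightmostPlus-EStep q (there {A = A} f s) = rightmostPlus-there i q A
    (trans (rightmostPlus-EStep (suc q) s) (cong just (ℕP.+-suc (fPos s) q)))
  rightmostPlus-EStep q (turn {A = A} f t ls) = rightmostPlus-here i q (lower A)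
    (signOf-plus i (lower A) (hasi-lower A) (hasj-lower A)) (rightmostPlus-Lacks i (suc q) ls)
  rightmostPlus-EStep q (pass {A = A} {C} {As} t t′ f t″ ls) = rightmostPlus-here i q (remL j A)
    (signOf-plus i (remL j A) (trans (hasi-remj A) t) (has-remL 1≤j j≤n A))
    no-plus
    where
    no-plus : rightmostPlus (signs i (suc q) (addL i C ∷ As)) ≡ nothing
    no-plus rewrite signOf-both i (addL i C) (has-addL 1≤i i≤n C) (trans (hasj-addi C) t″) =
      rightmostPlus-Lacks i (suc (suc q)) ls

  eAt-EStep : ∀ {k} {T T′ : Row n k} (s : EStep T T′) → eAt i (ePos s) T ≡ just T′
  eAt-EStep (there {A = A} {As} f s)  = eAt-∷ i (ePos s) A As f (eAt-EStep s)
  eAt-EStep (turn _ _ _)              = refl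
  eAt-EStep (pass t t′ _ _ _) rewrite t′ = refl

  raise-lower : (A : Box n) → has A i ≡ false → has A j ≡ true → remL i (addL j (lower A)) ≡ A
  raise-lower A f t = begin
    remL i (addL j (remL j (addL i A))) ≡⟨ cong (remL i) (setL-setL (addL i A) j) ⟩
    remL i (addL j (addL i A))          ≡⟨ cong (remL i) (setL-id (addL i A) j (trans (hasj-addi A) t)) ⟩
    remL i (addL i A)                   ≡⟨ setL-setL A i ⟩
    remL i A                            ≡⟨ setL-id A i f ⟩
    A ∎ where open ≡-Reasoning

  fAt-EStep : ∀ {k} {T T′ : Row n k} (s : EStep T T′) → fAt i (fPos s) T′ ≡ just T
  fAt-EStep (there {A = A} {As′ = As′} f s) = fAt-∷ i (fPos s) A As′ (fAt-EStep s)
  fAt-EStep (turn {A = A} f t [])        = cong (λ B → just (B ∷ [])) (raise-lower A f t)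
  fAt-EStep (turn {A = A} f t (_∷_ {x = C} {xs = As} l ls)) rewrite l = cong (λ B → just (B ∷ C ∷ As)) (raise-lower A f t)
  fAt-EStep (pass {A = A} {C} {As} t t′ f t″ ls) rewrite has-addL 1≤i i≤n C =
    cong₂ (λ A′ C′ → just (A′ ∷ C′ ∷ As))
          (trans (setL-setL A j) (setL-id A j t′))
          (trans (setL-setL C i) (setL-id C i f))

  e-EStep : ∀ {k} {T T′ : Row n k} → EStep T T′ → e i T ≡ just T′
  e-EStep {T = T} s = trans (e-eAt i (ePos s) unm) (eAt-EStep s)
    where
    unm : leftmostMinus (unmatched i T) ≡ just (ePos s)
    unm = trans (cong leftmostMinus (unmatched-signs i (EStep⇒NoPair s)))
                (trans (leftmostMinus-EStep 0 s) (cong just (ℕP.+-identityʳ _)))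

  f-EStep : ∀ {k} {T T′ : Row n k} → EStep T T′ → f i T′ ≡ just T
  f-EStep {T′ = T′} s = trans (f-fAt i (fPos s) unm) (fAt-EStep s)
    where
    unm : rightmostPlus (unmatched i T′) ≡ just (fPos s)
    unm = trans (cong rightmostPlus (unmatched-signs i (EStep⇒NoPair′ s)))
                (trans (rightmostPlus-EStep 0 s) (cong just (ℕP.+-identityʳ _)))

  EStep? : ∀ {k} (T : Row n k) → Ascending T → (∃ λ T′ → EStep T T′) ⊎ NoMinus T
  EStep? []       _ = inj₂ []
  EStep? (A ∷ As) (_ , A≼As , as) with has? A j
  ... | inj₂ f with EStep? As as
  ...   | inj₁ (As′ , s) = inj₁ (A ∷ As′ , there f s)
  ...   | inj₂ nm        = inj₂ ((λ t → clash t f) ∷ nm)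
  EStep? (A ∷ As) (_ , A≼As , as) | inj₁ t with has? A i
  EStep? (A ∷ As) (_ , A≼As , as) | inj₁ t | inj₂ f =
    inj₁ (_ , turn f t (lacks-above A (ℕP.n<1+n i) t A≼As))
  EStep? (A ∷ []) (_ , A≼As , as) | inj₁ t | inj₁ t′ = inj₂ ((λ _ → t′) ∷ [])
  EStep? (A ∷ C ∷ As) (_ , A≼As@(A≼C ∷ _) , (y , hy) , C≼As , as) | inj₁ t | inj₁ t′
    with lacks-above A (ℕP.n<1+n i) t A≼As | has? C j
  ... | f ∷ ls | inj₁ t″ = inj₁ (_ , pass t′ t f t″ ls)
  ... | _      | inj₂ f  = inj₂ ((λ _ → t′) ∷ (λ h → clash h f) ∷ Lacks⇒NoMinus lacksj)
    where
    -- A letter `y` of `C` is at least i + 1 because `A` contains i + 1, and it is not i + 1 because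
    -- `C` lacks it; so every box after `C` starts above i + 1.
    lacksj : Lacks j As
    lacksj = lacks-above C (ℕP.≤∧≢⇒< (A≼C j y t hy) λ { refl → clash hy f }) hy C≼As

  -- The danger is the new letter i. In `turn` the changed box contained i + 1, so the letters of
  -- `A` are at most i + 1, and this value is excluded; in `pass` the box on the left already
  -- contained i.
  EStep-≼ : ∀ {k} (A : Box n) {T T′ : Row n k} → has A j ≡ false → All (A ≼_) T → EStep T T′ → All (A ≼_) T′
  EStep-≼ A f (A≼C ∷ A≼T) (there _ s) = A≼C ∷ EStep-≼ A f A≼T s
  EStep-≼ A f (A≼C ∷ A≼T) (turn {A = C} _ t _) = A≼lower ∷ A≼T
    where
    A≼lower : A ≼ lower C
    A≼lower x y hx hy with lower-inv C hy
    ... | _ , inj₁ refl = ≤∧≢suc (A≼C x j hx t) λ { refl → clash hx f }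
    ... | _ , inj₂ hy′  = A≼C x y hx hy′
  EStep-≼ A f (A≼C ∷ A≼D ∷ A≼T) (pass {A = C} {D} t t′ _ t″ _) =
    (λ x y hx hy → A≼C x y hx (proj₂ (remL-inv 1≤j j≤n C hy))) ∷ A≼add ∷ A≼T
    where
    A≼add : A ≼ addL i D
    A≼add x y hx hy with addL-inv 1≤i i≤n D hy
    ... | inj₁ refl = A≼C x i hx t
    ... | inj₂ hy′  = A≼D x y hx hy′

  EStep-Ascending : ∀ {k} {T T′ : Row n k} → EStep T T′ → Ascending T → Ascending T′
  EStep-Ascending (there {A = A} f s) (ne , A≼As , as) = ne , EStep-≼ A f A≼As s , EStep-Ascending s as
  EStep-Ascending (turn {A = A} f t ls) (ne , A≼As , as) =
    (i , hasi-lower A) , VAll.map (λ {C} → lower≼ {C}) A≼As , as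
    where
    lower≼ : ∀ {C} → A ≼ C → lower A ≼ C
    lower≼ A≼C x y hx hy with lower-inv A hx
    ... | _ , inj₁ refl = ℕP.≤-trans (ℕP.n≤1+n i) (A≼C j y t hy)
    ... | _ , inj₂ hx′  = A≼C x y hx′ hy
  EStep-Ascending (pass {A = A} {C} t t′ f t″ ls) (ne , A≼C ∷ A≼As , _ , C≼As , as) =
    (i , trans (hasi-remj A) t) , rem≼add ∷ VAll.map (λ {D} → rem≼ {D}) A≼As
    , (i , has-addL 1≤i i≤n C) , VAll.map (λ {D} → add≼ {D}) C≼As , as
    where
    rem≼ : ∀ {D} → A ≼ D → remL j A ≼ D
    rem≼ A≼D x y hx hy = A≼D x y (proj₂ (remL-inv 1≤j j≤n A hx)) hy
    rem≼add : remL j A ≼ addL i C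
    rem≼add x y hx hy with remL-inv 1≤j j≤n A hx | addL-inv 1≤i i≤n C hy
    ... | neq , hx′ | inj₁ refl = ≤∧≢suc (A≼C x j hx′ t″) neq
    ... | neq , hx′ | inj₂ hy′  = A≼C x y hx′ hy′
    add≼ : ∀ {D} → C ≼ D → addL i C ≼ D
    add≼ C≼D x y hx hy with addL-inv 1≤i i≤n C hx
    ... | inj₁ refl = ℕP.≤-trans (ℕP.n≤1+n i) (C≼D j y t″ hy)
    ... | inj₂ hx′  = C≼D x y hx′ hy

  merge-remL : (A : Box n) → has A i ≡ true → has A j ≡ true → merge i A ≡ merge i (remL j A)
  merge-remL A t t′ = begin
    merge i A           ≡⟨ merge-≡ A t′ ⟩
    remL j (addL i A)   ≡⟨ cong (remL j) (setL-id A i t) ⟩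
    remL j A            ≡⟨ merge-Lacks (remL j A) (has-remL 1≤j j≤n A) ⟨
    merge i (remL j A)  ∎ where open ≡-Reasoning

  mergeRow-EStep : ∀ {k} {T T′ : Row n k} → EStep T T′ → mergeRow i T ≡ mergeRow i T′
  mergeRow-EStep (there _ s) = cong (_ ∷_) (mergeRow-EStep s)
  mergeRow-EStep (turn {A = A} f t ls) = cong (_∷ _) (trans (merge-≡ A t) (sym (merge-Lacks (lower A) (hasj-lower A))))
  mergeRow-EStep (pass {A = A} {C} t t′ f t″ ls) =
    cong₂ (λ A′ C′ → A′ ∷ C′ ∷ _) (merge-remL A t t′) mergeC
    where
    mergeC : merge i C ≡ merge i (addL i C)
    mergeC = begin
      merge i C                  ≡⟨ merge-≡ C t″ ⟩
      remL j (addL i C)          ≡⟨ cong (remL j) (setL-setL C i) ⟨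
      remL j (addL i (addL i C)) ≡⟨ merge-≡ (addL i C) (trans (hasj-addi C) t″) ⟨
      merge i (addL i C)         ∎ where open ≡-Reasoning

  isMinus : Box n → ℕ
  isMinus A = if has A j ∧ not (has A i) then 1 else 0

  -- The termination measure for `descent`: an e_i step removes exactly one -, in `pass` by turning
  -- the box of that - into one with both letters.
  minuses : ∀ {k} → Row n k → ℕ
  minuses []       = 0
  minuses (A ∷ As) = isMinus A + minuses As

  isMinus-0ᵢ : {A : Box n} → has A i ≡ true → isMinus A ≡ 0
  isMinus-0ᵢ {A} t with has A j
  ... | true rewrite t = refl
  ... | false = refl

  isMinus-1 : {A : Box n} → has A i ≡ false → has A j ≡ true → isMinus A ≡ 1
  isMinus-1 f t rewrite f | t = refl

  minuses-EStep : ∀ {k} {T T′ : Row n k} → EStep T T′ → minuses T ≡ suc (minuses T′)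
  minuses-EStep (there {A = A} f s) =
    trans (cong (isMinus A +_) (minuses-EStep s)) (ℕP.+-suc (isMinus A) _)
  minuses-EStep (turn {A = A} f t ls)
    rewrite isMinus-1 {A} f t | isMinus-0ᵢ {lower A} (hasi-lower A) = refl
  minuses-EStep (pass {A = A} {C} t t′ f t″ ls)
    rewrite isMinus-0ᵢ {A} t | isMinus-0ᵢ {remL j A} (trans (hasi-remj A) t) | isMinus-1 {C} f t″
          | isMinus-0ᵢ {addL i C} (has-addL 1≤i i≤n C) = refl

  -- The step of the K-operators

  data KStep : ∀ {k} → Row n k → Row n k → Set where
    there : ∀ {k A} {As As′ : Row n k} → has A j ≡ false → KStep As As′ → KStep (A ∷ As) (A ∷ As′)
    here  : ∀ {k A} {As : Row n k} → has A i ≡ true → has A j ≡ true → Lacks i As → Lacks j As →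
            KStep (A ∷ As) (remL j A ∷ As)

  -- Without a -, a box with i + 1 also contains i. After the first such box the order excludes i,
  -- and then the absence of - excludes i + 1 as well, so this box is the only one.
  KStep? : ∀ {k} (T : Row n k) → Ascending T → NoMinus T → (∃ λ T′ → KStep T T′) ⊎ Lacks j T
  KStep? []       _ _ = inj₂ []
  KStep? (A ∷ As) (_ , A≼As , as) (h ∷ nm) with has? A j
  ... | inj₁ t = inj₁ (_ , here (h t) t lacksi lacksj)
    where
    lacksi : Lacks i As
    lacksi = lacks-above A (ℕP.n<1+n i) t A≼As
    no-j : ∀ {C} → (has C j ≡ true → has C i ≡ true) × has C i ≡ false → has C j ≡ false
    no-j {C} (c , f) with has? C j
    ... | inj₁ t = clash (c t) f
    ... | inj₂ f = f
    lacksj : Lacks j As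
    lacksj = VAll.map (λ {C} → no-j {C}) (VAll.zip (nm , lacksi))
  ... | inj₂ f with KStep? As as nm
  ...   | inj₁ (_ , s) = inj₁ (_ , there f s)
  ...   | inj₂ ls      = inj₂ (f ∷ ls)

  KStep-Lacks : ∀ {k} {T T′ : Row n k} → KStep T T′ → Lacks j T′
  KStep-Lacks (there f s)       = f ∷ KStep-Lacks s
  KStep-Lacks (here {A = A} t t′ ls ls′) = has-remL 1≤j j≤n A ∷ ls′

  mergeRow-KStep : ∀ {k} {T T′ : Row n k} → KStep T T′ → mergeRow i T ≡ mergeRow i T′
  mergeRow-KStep (there _ s) = cong (_ ∷_) (mergeRow-KStep s)
  mergeRow-KStep (here {A = A} t t′ _ _) = cong (_∷ _) (merge-remL A t t′)

  KStep-≼ : ∀ {k} (A : Box n) {T T′ : Row n k} → All (A ≼_) T → KStep T T′ → All (A ≼_) T′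
  KStep-≼ A (A≼C ∷ A≼T) (there _ s) = A≼C ∷ KStep-≼ A A≼T s
  KStep-≼ A (A≼C ∷ A≼T) (here {A = C} _ _ _ _) =
    (λ x y hx hy → A≼C x y hx (proj₂ (remL-inv 1≤j j≤n C hy))) ∷ A≼T

  KStep-Ascending : ∀ {k} {T T′ : Row n k} → KStep T T′ → Ascending T → Ascending T′
  KStep-Ascending (there {A = A} f s) (ne , A≼As , as) = ne , KStep-≼ A A≼As s , KStep-Ascending s as
  KStep-Ascending (here {A = A} t t′ _ _) (ne , A≼As , as) =
    (i , trans (hasi-remj A) t) , VAll.map (λ {D} → rem≼ {D}) A≼As , as
    where
    rem≼ : ∀ {D} → A ≼ D → remL j A ≼ D
    rem≼ A≼D x y hx hy = A≼D x y (proj₂ (remL-inv 1≤j j≤n A hx)) hy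

  leftmostPos-nothing : ∀ {k} (P : Box n → Bool) p {T : Row n k} → All (λ A → P A ≡ false) T → leftmostPos P p T ≡ nothing
  leftmostPos-nothing P p []       = refl
  leftmostPos-nothing P p (f ∷ fs) rewrite f = leftmostPos-nothing P (suc p) fs

  rightmostPos-nothing : ∀ {k} (P : Box n → Bool) p {T : Row n k} → All (λ A → P A ≡ false) T → rightmostPos P p T ≡ nothing
  rightmostPos-nothing P p []       = refl
  rightmostPos-nothing P p {_ ∷ As} (f ∷ fs) rewrite rightmostPos-nothing P (suc p) fs | f = refl

  anyBox-false : ∀ {k} (P : Box n → Bool) {T : Row n k} → All (λ A → P A ≡ false) T → anyBox P T ≡ false
  anyBox-false P []       = refl
  anyBox-false P (f ∷ fs) rewrite f = anyBox-false P fs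

  both : Box n → Bool
  both A = has A i ∧ has A j

  both-false : {A : Box n} → has A j ≡ false → both A ≡ false
  both-false {A} f rewrite f = BoolP.∧-zeroʳ (has A i)

  kPos : ∀ {k} {T T′ : Row n k} → KStep T T′ → ℕ
  kPos (there _ s)      = suc (kPos s)
  kPos (here _ _ _ _)   = 0

  leftmostPos-KStep : ∀ {k} {T T′ : Row n k} q (s : KStep T T′) → leftmostPos both q T ≡ just (kPos s + q)
  leftmostPos-KStep q (there {A = A} f s) rewrite both-false {A} f =
    trans (leftmostPos-KStep (suc q) s) (cong just (ℕP.+-suc (kPos s) q))
  leftmostPos-KStep q (here t t′ _ _) rewrite t | t′ = refl

  rightmostPos-KStep : ∀ {k} {T T′ : Row n k} q (s : KStep T T′) →
                       rightmostPos (λ A → has A i) q T′ ≡ just (kPos s + q)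
  rightmostPos-KStep q (there {A = A} f s)
    rewrite trans (rightmostPos-KStep (suc q) s) (cong just (ℕP.+-suc (kPos s) q)) = refl
  rightmostPos-KStep q (here {A = A} t t′ ls _)
    rewrite rightmostPos-nothing (λ A → has A i) (suc q) ls | trans (hasi-remj A) t = refl

  anyBox-KStep : ∀ {k} {T T′ : Row n k} → KStep T T′ → anyBox (λ A → has A i) T′ ≡ true
  anyBox-KStep (there {A = A} f s) rewrite anyBox-KStep s with has A i
  ... | true  = refl
  ... | false = refl
  anyBox-KStep (here {A = A} t t′ _ _) rewrite trans (hasi-remj A) t = refl

  modifyAt-remL : ∀ {k} {T T′ : Row n k} (s : KStep T T′) → modifyAt (kPos s) (remL j) T ≡ T′
  modifyAt-remL (there f s)    = cong (_ ∷_) (modifyAt-remL s)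
  modifyAt-remL (here _ _ _ _) = refl

  modifyAt-addL : ∀ {k} {T T′ : Row n k} (s : KStep T T′) → modifyAt (kPos s) (addL j) T′ ≡ T
  modifyAt-addL (there f s)    = cong (_ ∷_) (modifyAt-addL s)
  modifyAt-addL (here {A = A} t t′ _ _) = cong (_∷ _) (trans (setL-setL A j) (setL-id A j t′))

  eK-KStep : ∀ {k} {T T′ : Row n k} → KStep T T′ → eK i T ≡ just T′
  eK-KStep s rewrite trans (leftmostPos-KStep 0 s) (cong just (ℕP.+-identityʳ _)) = cong just (modifyAt-remL s)

  -- The deletion leaves i + 1 nowhere in the row and i in no later box, so f_i^K is defined and
  -- restores the letter to the same box.
  fK-KStep : ∀ {k} {T T′ : Row n k} → KStep T T′ → fK i T′ ≡ just T
  fK-KStep s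
    rewrite anyBox-KStep s | anyBox-false (λ A → has A j) (KStep-Lacks s)
          | trans (rightmostPos-KStep 0 s) (cong just (ℕP.+-identityʳ _)) = cong just (modifyAt-addL s)

  Lacks⇒eK-nothing : ∀ {k} {T : Row n k} → Lacks j T → eK i T ≡ nothing
  Lacks⇒eK-nothing ls rewrite leftmostPos-nothing both 0 (VAll.map (λ {A} → both-false {A}) ls) = refl

  -- One induction yields both the maximal powers required by the Demazure condition and the path
  -- required for connectedness. The edges of the graph are those of f_i and f_i^K, so the path
  -- traverses them backwards.
  record Descent {k} (T U : Row n k) : Set where
    field
      {middle}  : Row n k
      e-max     : Max (e i) T middle
      eK-max    : Max (eK i) middle U
      ascending : Ascending U
      connected : Connected n k T U

  open Descent

  -- Every step preserves `mergeRow i`, and the final row lacks i + 1, where merging changes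
  -- nothing; so the final row is the merge of `T`.
  descent : ∀ {k} (T : Row n k) → Ascending T → Descent T (mergeRow i T)
  descent {k} T as = go (minuses T) T refl as
    where
    go : ∀ m (T : Row n k) → minuses T ≡ m → Ascending T → Descent T (mergeRow i T)
    go m T eq as with EStep? T as
    go zero T eq as | inj₁ (T′ , s) = case trans (sym eq) (minuses-EStep s) of λ ()
    go (suc m) T eq as | inj₁ (T′ , s)
      with go m T′ (ℕP.suc-injective (trans (sym (minuses-EStep s)) eq)) (EStep-Ascending s as)
    ... | d rewrite mergeRow-EStep s = record
      { e-max     = Max-step (e-EStep s) (e-max d)
      ; eK-max    = eK-max d
      ; ascending = ascending d
      ; connected = bwd (Ascending⇒SVT _ (EStep-Ascending s as) , Ascending⇒SVT _ as , i , valid , inj₁ (f-EStep s)) ◅ connected d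
      }
    go m T eq as | inj₂ nm with KStep? T as nm
    ... | inj₂ ls rewrite mergeRow-Lacks ls = record
      { e-max     = Max-refl (NoMinus⇒e-nothing nm)
      ; eK-max    = Max-refl (Lacks⇒eK-nothing ls)
      ; ascending = as
      ; connected = ε
      }
    ... | inj₁ (T′ , s) rewrite mergeRow-KStep s | mergeRow-Lacks (KStep-Lacks s) = record
      { e-max     = Max-refl (NoMinus⇒e-nothing nm)
      ; eK-max    = Max-step (eK-KStep s) (Max-refl (Lacks⇒eK-nothing (KStep-Lacks s)))
      ; ascending = KStep-Ascending s as
      ; connected = bwd (Ascending⇒SVT _ (KStep-Ascending s as) , Ascending⇒SVT _ as , i , valid , inj₂ (fK-KStep s)) ◅ ε
      }

-- The Demazure condition bounds the letters of a row

BoundedBox : ∀ {n} → ℕ → Box n → Set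
BoundedBox r A = ∀ x → has A x ≡ true → x ≤ r

Bounded : ∀ {n k} → ℕ → Row n k → Set
Bounded r = All (BoundedBox r)

-- The pull-back of the bound r along the map that sends i + 1 to i. The letter i + 1 becomes
-- admissible together with i, which changes the bound only when i is the largest admissible letter.
bump : ℕ → ℕ → ℕ
bump i r with i ≟ r
... | yes _ = suc r
... | no  _ = r

-- The number of letters that the successive merges of a word send to 1.
rank : List ℕ → ℕ
rank []       = 1
rank (i ∷ is) = bump i (rank is)

module _ {n : ℕ} (i : ℕ) (valid : ValidIndex n i) where

  Bounded-merge⇒ : ∀ r (A : Box n) → BoundedBox r (merge i A) → BoundedBox (bump i r) A
  Bounded-merge⇒ r A b x hx with has? A (suc i)
  Bounded-merge⇒ r A b x hx | inj₂ f rewrite merge-Lacks A f with i ≟ r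
  ... | yes refl = ℕP.m≤n⇒m≤1+n (b x hx)
  ... | no _     = b x hx
  Bounded-merge⇒ r A b x hx | inj₁ t rewrite merge-≡ A t with x ≟ suc i | i ≟ r
  ... | yes refl | yes refl = ℕP.≤-refl
  -- The merged box contains i, so i is at most r; being different from r, it leaves room for i + 1.
  ... | yes refl | no i≢r   = ℕP.≤∧≢⇒< (b i (hasi-lower i valid A)) i≢r
  ... | no x≢j   | yes refl = ℕP.m≤n⇒m≤1+n (b x (lower-mono i valid A x≢j hx))
  ... | no x≢j   | no _     = b x (lower-mono i valid A x≢j hx)

  Bounded-merge⇐ : ∀ r (A : Box n) → BoundedBox (bump i r) A → BoundedBox r (merge i A)
  Bounded-merge⇐ r A b x hx with has? A (suc i)
  Bounded-merge⇐ r A b x hx | inj₂ f rewrite merge-Lacks A f with i ≟ r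
  ... | yes refl = ≤∧≢suc (b x hx) λ { refl → clash hx f }
  ... | no _     = b x hx
  Bounded-merge⇐ r A b x hx | inj₁ t rewrite merge-≡ A t with lower-inv i valid A hx | i ≟ r
  ... | x≢j , inj₁ refl | yes refl = ℕP.≤-refl
  ... | x≢j , inj₁ refl | no _     = ℕP.<⇒≤ (b (suc i) t)
  ... | x≢j , inj₂ hx′  | yes refl = ≤∧≢suc (b x hx′) x≢j
  ... | x≢j , inj₂ hx′  | no _     = b x hx′

  Bounded-mergeRow⇒ : ∀ {k} r (T : Row n k) → Bounded r (mergeRow i T) → Bounded (bump i r) T
  Bounded-mergeRow⇒ r []       []       = []
  Bounded-mergeRow⇒ r (A ∷ As) (b ∷ bs) = Bounded-merge⇒ r A b ∷ Bounded-mergeRow⇒ r As bs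

  Bounded-mergeRow⇐ : ∀ {k} r (T : Row n k) → Bounded (bump i r) T → Bounded r (mergeRow i T)
  Bounded-mergeRow⇐ r []       []       = []
  Bounded-mergeRow⇐ r (A ∷ As) (b ∷ bs) = Bounded-merge⇐ r A b ∷ Bounded-mergeRow⇐ r As bs

has-one : ∀ {n} → 1 ≤ n → has (addL 1 (⊥ {n})) 1 ≡ true
has-one 1≤n = has-addL ℕP.≤-refl 1≤n ⊥

has-one-only : ∀ {n} → 1 ≤ n → ∀ x → has (addL 1 (⊥ {n})) x ≡ true → x ≡ 1
has-one-only {n} 1≤n x h with addL-inv ℕP.≤-refl 1≤n ⊥ h
... | inj₁ eq = eq
... | inj₂ h′ = clash h′ (has-⊥ n x)

u-Ascending : ∀ {n} k → 1 ≤ n → Ascending (u n k)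
u-Ascending zero    1≤n = tt
u-Ascending (suc k) 1≤n = (1 , has-one 1≤n) , one≼ k , u-Ascending k 1≤n
  where
  one≼ : ∀ k → All (addL 1 ⊥ ≼_) (u _ k)
  one≼ zero    = []
  one≼ (suc k) = (λ x y hx hy → ℕP.≤-reflexive (trans (has-one-only 1≤n x hx) (sym (has-one-only 1≤n y hy)))) ∷ one≼ k

u-Bounded : ∀ {n} k → 1 ≤ n → Bounded 1 (u n k)
u-Bounded zero    1≤n = []
u-Bounded (suc k) 1≤n = (λ x hx → ℕP.≤-reflexive (has-one-only 1≤n x hx)) ∷ u-Bounded k 1≤n

Bounded-1⇒u : ∀ {n k} → 1 ≤ n → (T : Row n k) → Ascending T → Bounded 1 T → T ≡ u n k
Bounded-1⇒u 1≤n []       _                  []       = refl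
Bounded-1⇒u {n} 1≤n (A ∷ As) ((y , hy) , _ , as) (b ∷ bs) =
  cong₂ _∷_ (has-ext A _ same) (Bounded-1⇒u 1≤n As as bs)
  where
  letter-1 : ∀ x → has A x ≡ true → x ≡ 1
  letter-1 x hx = ℕP.≤-antisym (b x hx) (proj₁ (has-bound A x hx))
  has-1 : has A 1 ≡ true
  has-1 = subst (λ z → has A z ≡ true) (letter-1 y hy) hy
  same : ∀ x → has A x ≡ has (addL 1 (⊥ {n})) x
  same x with has? A x | has? (addL 1 (⊥ {n})) x
  ... | inj₁ t | inj₁ t′ = trans t (sym t′)
  ... | inj₂ f | inj₂ f′ = trans f (sym f′)
  ... | inj₁ t | inj₂ f  = clash (subst (λ z → has (addL 1 (⊥ {n})) z ≡ true) (sym (letter-1 x t)) (has-one 1≤n)) f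
  ... | inj₂ f | inj₁ t  = clash (subst (λ z → has A z ≡ true) (sym (has-one-only 1≤n x t)) has-1) f

Bounded-n : ∀ {n k} (T : Row n k) → Bounded n T
Bounded-n []       = []
Bounded-n (A ∷ As) = (λ x hx → proj₂ (has-bound A x hx)) ∷ Bounded-n As

bump-refl : ∀ r → bump r r ≡ suc r
bump-refl r with r ≟ r
... | yes _  = refl
... | no r≢r = ⊥-elim (r≢r refl)

ValidWord : ℕ → List ℕ → Set
ValidWord n = LAll.All (ValidIndex n)

module _ {n k : ℕ} (1≤n : 1 ≤ n) where

  open Descent

  DemChain⇒Bounded : ∀ word → ValidWord n word → (T : Row n k) → Ascending T →
                     DemChain word T (u n k) → Bounded (rank word) T
  DemChain⇒Bounded []       _                T as refl = u-Bounded k 1≤n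
  DemChain⇒Bounded (i ∷ is) (v LAll.∷ vs) T as (T₁ , T₂ , m₁ , m₂ , chain)
    with descent i v T as
  -- Maximal powers are unique, so the two rows supplied by the chain are those of `descent`, the
  -- second one being the merge.
  ... | d with Max-unique m₁ (e-max d)
  ... | refl with Max-unique m₂ (eK-max d)
  ... | refl = Bounded-mergeRow⇒ i v (rank is) T (DemChain⇒Bounded is vs _ (ascending d) chain)

  Bounded⇒DemChain : ∀ word → ValidWord n word → (T : Row n k) → Ascending T →
                     Bounded (rank word) T → DemChain word T (u n k)
  Bounded⇒DemChain []       _             T as b = Bounded-1⇒u 1≤n T as b
  Bounded⇒DemChain (i ∷ is) (v LAll.∷ vs) T as b =
    _ , _ , e-max d , eK-max d ,
    Bounded⇒DemChain is vs _ (ascending d) (Bounded-mergeRow⇐ i v (rank is) T b)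
    where
    d : Descent i v T (mergeRow i T)
    d = descent i v T as

  InDem⇒ : ∀ {word} → ValidWord n word → {T : Row n k} → InDem n k word T → Ascending T × Bounded (rank word) T
  InDem⇒ {word} vs {T} (svt , chain) = as , DemChain⇒Bounded word vs T as chain
    where as = SVT⇒Ascending T svt

  ⇒InDem : ∀ {word} → ValidWord n word → {T : Row n k} → Ascending T × Bounded (rank word) T → InDem n k word T
  ⇒InDem {word} vs {T} (as , b) = Ascending⇒SVT T as , Bounded⇒DemChain word vs T as b

  -- Merging the largest admissible letter into the one below lowers the bound by one; continuing
  -- down to the bound 1 leaves only `u`.
  connected-u : ∀ r → 1 ≤ r → r ≤ n → (T : Row n k) → Ascending T → Bounded r T → Connected n k T (u n k)
  connected-u (suc zero)    _ _   T as b rewrite Bounded-1⇒u 1≤n T as b = ε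
  connected-u (suc (suc r)) _ r<n T as b =
    connected d ◅◅ connected-u (suc r) (s≤s z≤n) (ℕP.<⇒≤ r<n) _ (ascending d)
      (Bounded-mergeRow⇐ (suc r) v (suc r) T (subst (λ z → Bounded z T) (sym (bump-refl (suc r))) b))
    where
    v : ValidIndex n (suc r)
    v = s≤s z≤n , r<n
    d : Descent (suc r) v T (mergeRow (suc r) T)
    d = descent (suc r) v T as

  connected-SVT : (T T′ : Row n k) → SVT T → SVT T′ → Connected n k T T′
  connected-SVT T T′ s s′ = to-u T s ◅◅ Star.reverse (Sym.symmetric (Edge n k)) (to-u T′ s′)
    where
    to-u : ∀ T → SVT T → Connected n k T (u n k)
    to-u T s = connected-u n 1≤n ℕP.≤-refl T (SVT⇒Ascending T s) (Bounded-n T)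

  -- If e_i and e_i^K vanish on `T`, its descent is trivial, so `T` equals its own merge for every
  -- i. The downward walk on the bound then takes place without changing `T`.
  highest-weight-unique : (T : Row n k) → SVT T →
    (∀ i → ValidIndex n i → e i T ≡ nothing × eK i T ≡ nothing) → T ≡ u n k
  highest-weight-unique T s hw = go n 1≤n ℕP.≤-refl (Bounded-n T)
    where
    as : Ascending T
    as = SVT⇒Ascending T s
    fixed : ∀ i → ValidIndex n i → mergeRow i T ≡ T
    fixed i v with descent i v T as
    ... | d with Max-unique (e-max d) (Max-refl (proj₁ (hw i v)))
    ... | refl = Max-unique (eK-max d) (Max-refl (proj₂ (hw i v)))
    go : ∀ r → 1 ≤ r → r ≤ n → Bounded r T → T ≡ u n k
    go (suc zero)    _ _   b = Bounded-1⇒u 1≤n T as b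
    go (suc (suc r)) _ r<n b = go (suc r) (s≤s z≤n) (ℕP.<⇒≤ r<n)
      (subst (Bounded (suc r)) (fixed (suc r) v)
        (Bounded-mergeRow⇐ (suc r) v (suc r) T (subst (λ z → Bounded z T) (sym (bump-refl (suc r))) b)))
      where
      v : ValidIndex n (suc r)
      v = s≤s z≤n , r<n

  u-highest-weight : ∀ i → ValidIndex n i → e i (u n k) ≡ nothing × eK i (u n k) ≡ nothing
  u-highest-weight i v@(1≤i , _) =
    NoMinus⇒e-nothing i v (Lacks⇒NoMinus i v lacks) , Lacks⇒eK-nothing i v lacks
    where
    no-letter : ∀ {A : Box n} → BoundedBox 1 A → has A (suc i) ≡ false
    no-letter {A} b with has? A (suc i)
    ... | inj₁ t = ⊥-elim (ℕP.<⇒≱ (s≤s 1≤i) (b (suc i) t))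
    ... | inj₂ f = f
    lacks : Lacks (suc i) (u n k)
    lacks = VAll.map (λ {A} → no-letter {A}) (u-Bounded k 1≤n)

-- Reduced words

≡ᵇ-refl : ∀ x → (x ≡ᵇ x) ≡ true
≡ᵇ-refl zero    = refl
≡ᵇ-refl (suc x) = ≡ᵇ-refl x

≡ᵇ-≢ : ∀ {x y} → x ≢ y → (x ≡ᵇ y) ≡ false
≡ᵇ-≢ {x} {y} x≢y with x ≡ᵇ y in eq
... | true  = ⊥-elim (x≢y (ℕP.≡ᵇ⇒≡ x y (subst T (sym eq) tt)))
... | false = refl

sAct-i : ∀ i → sAct i i ≡ suc i
sAct-i i rewrite ≡ᵇ-refl i = refl

sAct-suc : ∀ i → sAct i (suc i) ≡ i
sAct-suc i rewrite ≡ᵇ-≢ (j≢i {i}) | ≡ᵇ-refl i = refl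

sAct-other : ∀ i {x} → x ≢ i → x ≢ suc i → sAct i x ≡ x
sAct-other i x≢i x≢j rewrite ≡ᵇ-≢ x≢i | ≡ᵇ-≢ x≢j = refl

sAct-involutive : ∀ i x → sAct i (sAct i x) ≡ x
sAct-involutive i x with x ≟ i | x ≟ suc i
... | yes refl | _        = trans (cong (sAct x) (sAct-i x)) (sAct-suc x)
... | no _     | yes refl = trans (cong (sAct i) (sAct-suc i)) (sAct-i i)
... | no x≢i   | no x≢j   = trans (cong (sAct i) (sAct-other i x≢i x≢j)) (sAct-other i x≢i x≢j)

sAct-injective : ∀ i {x y} → sAct i x ≡ sAct i y → x ≡ y
sAct-injective i {x} {y} eq = trans (sym (sAct-involutive i x)) (trans (cong (sAct i) eq) (sAct-involutive i y))

wordAct-injective : ∀ word {x y} → wordAct word x ≡ wordAct word y → x ≡ y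
wordAct-injective []       eq = eq
wordAct-injective (i ∷ is) eq = wordAct-injective is (sAct-injective i eq)

wordAct-surjective : ∀ word y → ∃ λ x → wordAct word x ≡ y
wordAct-surjective []       y = y , refl
wordAct-surjective (i ∷ is) y with wordAct-surjective is (sAct i y)
... | x , eq = x , trans (cong (sAct i) eq) (sAct-involutive i y)

sAct-inversion : ∀ i {a b} → a < b → sAct i b < sAct i a → a ≡ i × b ≡ suc i
sAct-inversion i {a} {b} a<b inv with a ≟ i | a ≟ suc i | b ≟ i | b ≟ suc i
... | yes eq | _ | _ | yes eq′ = eq , eq′
... | yes refl | _ | _ | no b≢j = ⊥-elim (ℕP.<⇒≱
  (subst₂ _<_ (sAct-other i (ℕP.<⇒≢ a<b ∘ sym) b≢j) (sAct-i i) inv) a<b)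
... | no _ | yes refl | _ | _ = ⊥-elim (ℕP.<-asym a<b (ℕP.<-trans
  (subst₂ _<_ (sAct-other i (λ { refl → ℕP.<-asym a<b (ℕP.n<1+n b) }) (ℕP.<⇒≢ a<b ∘ sym)) (sAct-suc i) inv)
  (ℕP.n<1+n i)))
... | no a≢i | no a≢j | yes refl | _ = ⊥-elim (ℕP.<-asym a<b
  (ℕP.<-trans (ℕP.n<1+n b) (subst₂ _<_ (sAct-i b) (sAct-other i a≢i a≢j) inv)))
... | no a≢i | no a≢j | no _ | yes refl = ⊥-elim (ℕP.<⇒≱
  (subst₂ _<_ (sAct-suc i) (sAct-other i a≢i a≢j) inv) (ℕP.≤-pred a<b))
... | no a≢i | no a≢j | no b≢i | no b≢j = ⊥-elim (ℕP.<-asym a<b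
  (subst₂ _<_ (sAct-other i b≢i b≢j) (sAct-other i a≢i a≢j) inv))

-- Exchange: deleting one letter of a word that inverts x < y precomposes it with the transposition (x y).
exchange : ∀ {n} word → ValidWord n word → ∀ {x y} → x < y → wordAct word y < wordAct word x →
  ∃ λ word′ → ValidWord n word′ × suc (length word′) ≡ length word
    × wordAct word′ x ≡ wordAct word y × wordAct word′ y ≡ wordAct word x
    × (∀ z → z ≢ x → z ≢ y → wordAct word′ z ≡ wordAct word z)
exchange []       _             x<y inv = ⊥-elim (ℕP.<-asym x<y inv)
exchange (i ∷ is) (v LAll.∷ vs) {x} {y} x<y inv with ℕP.<-cmp (wordAct is x) (wordAct is y)
... | tri≈ _ eq _ = ⊥-elim (ℕP.<⇒≢ x<y (wordAct-injective is eq))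
... | tri> _ _ gt with exchange is vs x<y gt
...   | is′ , vs′ , len , eqx , eqy , eqz =
  i ∷ is′ , v LAll.∷ vs′ , cong suc len , cong (sAct i) eqx , cong (sAct i) eqy
  , λ z z≢x z≢y → cong (sAct i) (eqz z z≢x z≢y)
exchange (i ∷ is) (v LAll.∷ vs) {x} {y} x<y inv | tri< lt _ _ with sAct-inversion i lt inv
...   | eqx , eqy = is , vs , refl
  , trans eqx (sym (trans (cong (sAct i) eqy) (sAct-suc i)))
  , trans eqy (sym (trans (cong (sAct i) eqx) (sAct-i i)))
  , λ z z≢x z≢y → sym (sAct-other i
      (λ eq → z≢x (wordAct-injective is (trans eq (sym eqx))))
      (λ eq → z≢y (wordAct-injective is (trans eq (sym eqy)))))

-- Words act on all natural numbers. That 0 is fixed makes 1 the smallest position available to the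
-- exchange argument.
wordAct-zero : ∀ {n} word → ValidWord n word → wordAct word 0 ≡ 0
wordAct-zero []       _                       = refl
wordAct-zero (i ∷ is) ((1≤i , _) LAll.∷ vs) rewrite wordAct-zero is vs =
  sAct-other i (ℕP.<⇒≢ 1≤i) λ ()

-- Reducedness expressed by the action alone, with no permutation named, so that it passes to the
-- tail of a word.
Minimal : ℕ → List ℕ → Set
Minimal n word = ∀ word′ → ValidWord n word′ → (∀ z → wordAct word′ z ≡ wordAct word z) →
                 length word ≤ length word′

Minimal-tail : ∀ {n i} is → ValidIndex n i → Minimal n (i ∷ is) → Minimal n is
Minimal-tail {i = i} is v min is′ vs′ eq =
  ℕP.≤-pred (min (i ∷ is′) (v LAll.∷ vs′) (λ z → cong (sAct i) (eq z)))

-- Suppose `is` sends 1 to i + 1, and let `y` be the position sent to i. Then 1 < y is an inversion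
-- of `is`, and precomposing with (1 y) has the same effect as postcomposing with s_i. The exchange
-- thus produces a word with the action of `i ∷ is` and two letters fewer.
Minimal⇒ascent : ∀ {n i} is → ValidIndex n i → ValidWord n is → Minimal n (i ∷ is) → wordAct is 1 ≢ suc i
Minimal⇒ascent {n} {i} is (1≤i , _) vs min eq with wordAct-surjective is i
... | y , eqy with exchange is vs 1<y (subst₂ _<_ (sym eqy) (sym eq) (ℕP.n<1+n i))
  where
  1<y : 1 < y
  1<y = ℕP.≤∧≢⇒<
    (ℕP.n≢0⇒n>0 λ { refl → ℕP.<⇒≢ 1≤i (trans (sym (wordAct-zero is vs)) eqy) })
    λ { refl → i≢j (trans (sym eqy) eq) }
...   | is′ , vs′ , len , eq1 , eq′y , eqz = ℕP.<⇒≱ (ℕP.n<1+n _)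
  (ℕP.≤-trans (ℕP.n≤1+n _)
    (subst (λ l → suc l ≤ length is′) (sym len) (min is′ vs′ same)))
  where
  same : ∀ z → wordAct is′ z ≡ wordAct (i ∷ is) z
  same z with z ≟ 1 | z ≟ y
  ... | yes refl | _ = trans eq1 (trans eqy (sym (trans (cong (sAct i) eq) (sAct-suc i))))
  ... | no _ | yes refl = trans eq′y (trans eq (sym (trans (cong (sAct i) eqy) (sAct-i i))))
  ... | no z≢1 | no z≢y = trans (eqz z z≢1 z≢y) (sym (sAct-other i
    (λ h → z≢y (wordAct-injective is (trans h (sym eqy))))
    (λ h → z≢1 (wordAct-injective is (trans h (sym eq))))))

-- `bump i` and s_i agree at every r except r = i + 1, which `Minimal⇒ascent` excludes for the image
-- of 1.
rank-Minimal : ∀ {n} word → ValidWord n word → Minimal n word → rank word ≡ wordAct word 1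
rank-Minimal []       _                 _   = refl
rank-Minimal (i ∷ is) (v LAll.∷ vs) min
  rewrite rank-Minimal is vs (Minimal-tail is v min) with i ≟ wordAct is 1
... | yes eq = sym (trans (cong (sAct i) (sym eq)) (trans (sAct-i i) (cong suc eq)))
... | no neq = sym (sAct-other i (neq ∘ sym) (Minimal⇒ascent is v vs min))

Reduced⇒Minimal : ∀ {n w} word → Reduced n w word → Minimal n word
Reduced⇒Minimal word ((_ , acts) , min) word′ vs′ eq =
  min word′ (vs′ , λ x → trans (eq (suc (toℕ x))) (acts x))

rank-Reduced : ∀ {n w word} → 1 ≤ n → Reduced n w word → ∀ {word′} → Reduced n w word′ → rank word ≡ rank word′
rank-Reduced {suc n} {w} {word} _ red {word′} red′ = trans (rank-w red) (sym (rank-w red′))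
  where
  rank-w : ∀ {word} → Reduced (suc n) w word → rank word ≡ suc (toℕ (w ⟨$⟩ʳ zero))
  rank-w {word} red@((vs , acts) , _) = trans (rank-Minimal word vs (Reduced⇒Minimal {w = w} word red)) (acts zero)

-- Fibres of the merge

if-true : ∀ {X : Set} {b} {x y : X} → b ≡ true → (if b then x else y) ≡ x
if-true refl = refl

if-false : ∀ {X : Set} {b} {x y : X} → b ≡ false → (if b then x else y) ≡ y
if-false refl = refl

module _ {n : ℕ} (i : ℕ) (valid : ValidIndex n i) where

  open Index valid

  private
    j = suc i

  raise-≡ : (A : Box n) → has A i ≡ true → raise i A ≡ remL i (addL j A)
  raise-≡ A h rewrite h = refl

  raise-Lacks : (A : Box n) → has A i ≡ false → raise i A ≡ A
  raise-Lacks A h rewrite h = refl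

  hasi-raise : (A : Box n) → has (raise i A) i ≡ false
  hasi-raise A with has? A i
  ... | inj₁ t rewrite raise-≡ A t = has-remL 1≤i i≤n (addL j A)
  ... | inj₂ f rewrite raise-Lacks A f = f

  hasj-raise : (A : Box n) → has A i ≡ true → has (raise i A) j ≡ true
  hasj-raise A t rewrite raise-≡ A t = remL-keep 1≤i i≤n (addL j A) j≢i (has-addL 1≤j j≤n A)

  raise-inv : (A : Box n) → ∀ {x} → has (raise i A) x ≡ true →
              (x ≡ j × has A i ≡ true) ⊎ (x ≢ i × has A x ≡ true)
  raise-inv A {x} h with has? A i
  ... | inj₂ f rewrite raise-Lacks A f = inj₂ ((λ { refl → clash h f }) , h)
  ... | inj₁ t rewrite raise-≡ A t with remL-inv 1≤i i≤n (addL j A) h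
  ...   | x≢i , h′ with addL-inv 1≤j j≤n A h′
  ...     | inj₁ x≡j = inj₁ (x≡j , t)
  ...     | inj₂ h″  = inj₂ (x≢i , h″)

  -- Since `A` contains i, the letters of `C` are at least i, and raising moves those equal to i up
  -- to i + 1.
  addL≼raise : {A C : Box n} → has A i ≡ true → A ≼ C → addL j A ≼ raise i C
  addL≼raise {A} {C} t A≼C x y hx hy with addL-inv 1≤j j≤n A hx | raise-inv C hy
  ... | inj₁ refl | inj₁ (refl , _)   = ℕP.≤-refl
  ... | inj₁ refl | inj₂ (y≢i , hy′)  = ℕP.≤∧≢⇒< (A≼C i y t hy′) (y≢i ∘ sym)
  ... | inj₂ hx′  | inj₁ (refl , t′)  = ℕP.m≤n⇒m≤1+n (A≼C x i hx′ t′)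
  ... | inj₂ hx′  | inj₂ (_ , hy′)    = A≼C x y hx′ hy′

  raise≼raise : {A C : Box n} → A ≼ C → raise i A ≼ raise i C
  raise≼raise {A} {C} A≼C x y hx hy with raise-inv A hx | raise-inv C hy
  ... | inj₁ (refl , _) | inj₁ (refl , _)  = ℕP.≤-refl
  ... | inj₁ (refl , t) | inj₂ (y≢i , hy′) = ℕP.≤∧≢⇒< (A≼C i y t hy′) (y≢i ∘ sym)
  ... | inj₂ (_ , hx′)  | inj₁ (refl , t′) = ℕP.m≤n⇒m≤1+n (A≼C x i hx′ t′)
  ... | inj₂ (_ , hx′)  | inj₂ (_ , hy′)   = A≼C x y hx′ hy′

  ≼raiseRow : ∀ {k} (A B : Box n) → (∀ {C} → A ≼ C → B ≼ raise i C) →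
              (T : Row n k) → All (A ≼_) T → All (B ≼_) (raiseRow i T)
  ≼raiseRow A B f []       []       = []
  ≼raiseRow A B f (C ∷ Cs) (c ∷ cs) = f {C} c ∷ ≼raiseRow A B (λ {C} → f {C}) Cs cs

  Inhabited-raise : (A : Box n) → Inhabited A → Inhabited (raise i A)
  Inhabited-raise A (x , h) with has? A i
  ... | inj₁ t = j , hasj-raise A t
  ... | inj₂ f = x , trans (cong (λ B → has B x) (raise-Lacks A f)) h

  raiseRow-Ascending : ∀ {k} (T : Row n k) → Ascending T → Ascending (raiseRow i T)
  raiseRow-Ascending []       _ = tt
  raiseRow-Ascending (A ∷ As) (ne , A≼As , as) =
    Inhabited-raise A ne , ≼raiseRow A (raise i A) (λ {C} → raise≼raise {A} {C}) As A≼As , raiseRow-Ascending As as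

  merge-raise : (A : Box n) → has A j ≡ false → merge i (raise i A) ≡ A
  merge-raise A f with has? A i
  ... | inj₂ f′ rewrite raise-Lacks A f′ = merge-Lacks A f
  ... | inj₁ t = begin
    merge i (raise i A)                        ≡⟨ merge-≡ (raise i A) (hasj-raise A t) ⟩
    remL j (addL i (raise i A))                ≡⟨ cong (remL j ∘ addL i) (raise-≡ A t) ⟩
    remL j (addL i (remL i (addL j A)))        ≡⟨ cong (remL j) (setL-setL (addL j A) i) ⟩
    remL j (addL i (addL j A))                 ≡⟨ cong (remL j) (setL-comm A j i j≢i) ⟩
    remL j (addL j (addL i A))                 ≡⟨ setL-setL (addL i A) j ⟩
    remL j (addL i A)                          ≡⟨ cong (remL j) (setL-id A i t) ⟩
    remL j A                                   ≡⟨ setL-id A j f ⟩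
    A ∎ where open ≡-Reasoning

  mergeRow-raiseRow : ∀ {k} {T : Row n k} → Lacks j T → mergeRow i (raiseRow i T) ≡ T
  mergeRow-raiseRow []       = refl
  mergeRow-raiseRow {T = A ∷ _} (f ∷ fs) = cong₂ _∷_ (merge-raise A f) (mergeRow-raiseRow fs)

  merge-addL : (A : Box n) → has A i ≡ true → has A j ≡ false → merge i (addL j A) ≡ A
  merge-addL A t f = begin
    merge i (addL j A)          ≡⟨ merge-≡ (addL j A) (has-addL 1≤j j≤n A) ⟩
    remL j (addL i (addL j A))  ≡⟨ cong (remL j) (setL-comm A j i j≢i) ⟩
    remL j (addL j (addL i A))  ≡⟨ setL-setL (addL i A) j ⟩
    remL j (addL i A)           ≡⟨ cong (remL j) (setL-id A i t) ⟩
    remL j A                    ≡⟨ setL-id A j f ⟩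
    A ∎ where open ≡-Reasoning

  raise-merge : (A : Box n) → has A i ≡ false → raise i (merge i A) ≡ A
  raise-merge A f with has? A j
  ... | inj₂ f′ rewrite merge-Lacks A f′ = raise-Lacks A f
  ... | inj₁ t rewrite merge-≡ A t =
    trans (raise-≡ (lower i valid A) (hasi-lower i valid A)) (raise-lower i valid A f t)

  raiseRow-mergeRow : ∀ {k} {T : Row n k} → Lacks i T → raiseRow i (mergeRow i T) ≡ T
  raiseRow-mergeRow []       = refl
  raiseRow-mergeRow {T = A ∷ _} (f ∷ fs) = cong₂ _∷_ (raise-merge A f) (raiseRow-mergeRow fs)

  -- For a row without i + 1, the recursion decides whether `A` is the first box to receive i + 1.
  -- If so, it either gives up i or keeps it, and every later i must be raised, since no i may
  -- follow an i + 1.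
  fibre : ∀ {k} → Row n k → List (Row n k)
  fibre []       = [] ∷ []
  fibre (A ∷ As) = if has A i
    then (raise i A ∷ raiseRow i As) ∷ (addL j A ∷ raiseRow i As) ∷ map (A ∷_) (fibre As)
    else map (A ∷_) (fibre As)

  fibre-true : ∀ {k} (A : Box n) (As : Row n k) → has A i ≡ true → fibre (A ∷ As) ≡
    (raise i A ∷ raiseRow i As) ∷ (addL j A ∷ raiseRow i As) ∷ map (A ∷_) (fibre As)
  fibre-true A As t = if-true t

  fibre-false : ∀ {k} (A : Box n) (As : Row n k) → has A i ≡ false → fibre (A ∷ As) ≡ map (A ∷_) (fibre As)
  fibre-false A As f = if-false f

  -- An unchanged head occurs in both branches of `fibre`; the view joins them, so that membership
  -- arguments split only by the fate of the head.
  data FibreView {k} (A : Box n) (As : Row n k) : Row n (suc k) → Set where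
    stay  : ∀ {t} → t LMem.∈ fibre As → FibreView A As (A ∷ t)
    bound : has A i ≡ true → FibreView A As (addL j A ∷ raiseRow i As)
    up    : has A i ≡ true → FibreView A As (raise i A ∷ raiseRow i As)

  ∈fibre⇒view : ∀ {k} (A : Box n) (As : Row n k) {T} → T LMem.∈ fibre (A ∷ As) → FibreView A As T
  ∈fibre⇒view A As {T} p with has? A i
  ... | inj₁ t = split (subst (T LMem.∈_) (fibre-true A As t) p)
    where
    split : T LMem.∈ _ → FibreView A As T
    split (LAny.here refl)              = up t
    split (LAny.there (LAny.here refl)) = bound t
    split (LAny.there (LAny.there p)) with LMemP.∈-map⁻ (A ∷_) p
    ... | _ , q , refl = stay q
  ... | inj₂ f with LMemP.∈-map⁻ (A ∷_) (subst (T LMem.∈_) (fibre-false A As f) p)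
  ...   | _ , q , refl = stay q

  view⇒∈fibre : ∀ {k} (A : Box n) (As : Row n k) {T} → FibreView A As T → T LMem.∈ fibre (A ∷ As)
  view⇒∈fibre A As (stay q) with has? A i
  ... | inj₁ t = subst (_ LMem.∈_) (sym (fibre-true A As t)) (LAny.there (LAny.there (LMemP.∈-map⁺ (A ∷_) q)))
  ... | inj₂ f = subst (_ LMem.∈_) (sym (fibre-false A As f)) (LMemP.∈-map⁺ (A ∷_) q)
  view⇒∈fibre A As (bound t) = subst (addL j A ∷ raiseRow i As LMem.∈_) (sym (fibre-true A As t)) (LAny.there (LAny.here refl))
  view⇒∈fibre A As (up t)    = subst (raise i A ∷ raiseRow i As LMem.∈_) (sym (fibre-true A As t)) (LAny.here refl)

  ∈fibre⇒mergeRow : ∀ {k} (T₀ : Row n k) → Lacks j T₀ → ∀ {T} → T LMem.∈ fibre T₀ → mergeRow i T ≡ T₀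
  ∈fibre⇒mergeRow []       _        (LAny.here refl) = refl
  ∈fibre⇒mergeRow (A ∷ As) (f ∷ fs) p with ∈fibre⇒view A As p
  ... | stay q  = cong₂ _∷_ (merge-Lacks A f) (∈fibre⇒mergeRow As fs q)
  ... | bound t = cong₂ _∷_ (merge-addL A t f) (mergeRow-raiseRow fs)
  ... | up t    = cong₂ _∷_ (merge-raise A f) (mergeRow-raiseRow fs)

  -- Merging only lowers letters, so what precedes the merge precedes the box itself. This carries
  -- the order of T₀ over to the rows of its fibre.
  ≼merge⇒≼ : {A : Box n} (C : Box n) → A ≼ merge i C → A ≼ C
  ≼merge⇒≼ C A≼C x y hx hy with has? C j
  ... | inj₂ f rewrite merge-Lacks C f = A≼C x y hx hy
  ... | inj₁ t rewrite merge-≡ C t with y ≟ j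
  ...   | yes refl = ℕP.m≤n⇒m≤1+n (A≼C x i hx (hasi-lower i valid C))
  ...   | no y≢j   = A≼C x y hx (lower-mono i valid C y≢j hy)

  ≼mergeRow⇒≼ : ∀ {k} (A : Box n) (T : Row n k) → All (A ≼_) (mergeRow i T) → All (A ≼_) T
  ≼mergeRow⇒≼ A []       []       = []
  ≼mergeRow⇒≼ A (C ∷ Cs) (c ∷ cs) = ≼merge⇒≼ {A} C c ∷ ≼mergeRow⇒≼ A Cs cs

  ∈fibre⇒Ascending : ∀ {k} (T₀ : Row n k) → Lacks j T₀ → Ascending T₀ → ∀ {T} → T LMem.∈ fibre T₀ → Ascending T
  ∈fibre⇒Ascending []       _        _                  (LAny.here refl) = tt
  ∈fibre⇒Ascending (A ∷ As) (f ∷ fs) (ne , A≼As , as) p with ∈fibre⇒view A As p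
  ... | stay {t} q = ne , ≼mergeRow⇒≼ A t (subst (All (A ≼_)) (sym (∈fibre⇒mergeRow As fs q)) A≼As)
                   , ∈fibre⇒Ascending As fs as q
  ... | bound t = (j , has-addL 1≤j j≤n A) , ≼raiseRow A (addL j A) (λ {C} → addL≼raise {A} {C} t) As A≼As , raiseRow-Ascending As as
  ... | up t    = raiseRow-Ascending (A ∷ As) (ne , A≼As , as)

  Ascending⇒∈fibre : ∀ {k} (T : Row n k) → Ascending T → T LMem.∈ fibre (mergeRow i T)
  Ascending⇒∈fibre []       _ = LAny.here refl
  Ascending⇒∈fibre (B ∷ Bs) (_ , B≼Bs , bs) with has? B j
  ... | inj₂ f rewrite merge-Lacks B f = view⇒∈fibre B (mergeRow i Bs) (stay (Ascending⇒∈fibre Bs bs))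
  ... | inj₁ t = view⇒∈fibre (merge i B) (mergeRow i Bs) (view (has? B i))
    where
    -- `B` contains i + 1, so the later boxes lack i, and on such boxes raising undoes merging.
    rest : raiseRow i (mergeRow i Bs) ≡ Bs
    rest = raiseRow-mergeRow (lacks-above B (ℕP.n<1+n i) t B≼Bs)
    hasi-merge : has (merge i B) i ≡ true
    hasi-merge rewrite merge-≡ B t = hasi-lower i valid B
    addL-merge : has B i ≡ true → addL j (merge i B) ≡ B
    addL-merge t′ = begin
      addL j (merge i B)         ≡⟨ cong (addL j) (merge-≡ B t) ⟩
      addL j (remL j (addL i B)) ≡⟨ setL-setL (addL i B) j ⟩
      addL j (addL i B)          ≡⟨ cong (addL j) (setL-id B i t′) ⟩
      addL j B                   ≡⟨ setL-id B j t ⟩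
      B ∎ where open ≡-Reasoning
    view : has B i ≡ true ⊎ has B i ≡ false → FibreView (merge i B) (mergeRow i Bs) (B ∷ Bs)
    view (inj₁ t′) = subst (FibreView _ _) (cong₂ _∷_ (addL-merge t′) rest) (bound hasi-merge)
    view (inj₂ f)  = subst (FibreView _ _) (cong₂ _∷_ (raise-merge B f) rest) (up hasi-merge)

  fibre-Unique : ∀ {k} (T₀ : Row n k) → Lacks j T₀ → Unique (fibre T₀)
  fibre-Unique []       _        = LAll.[] AP.∷ AP.[]
  fibre-Unique (A ∷ As) (f ∷ fs) with has? A i
  ... | inj₂ f′ = subst Unique (sym (fibre-false A As f′)) (UniqueP.map⁺ VecP.∷-injectiveʳ (fibre-Unique As fs))
  ... | inj₁ t  = subst Unique (sym (fibre-true A As t))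
    -- The three kinds of head are told apart by two letters: the raised one lacks i, the doubled
    -- one has i and i + 1, and the unchanged one has i without i + 1.
    ((differ (raise i A) i (hasi-raise A) (trans (has-setL-other A j true i i≢j) t)
        LAll.∷ LAllP.map⁺ (LAll.universal (λ _ → differ (raise i A) i (hasi-raise A) t) (fibre As)))
      AP.∷ LAllP.map⁺ (LAll.universal (λ _ → differ (addL j A) j (has-addL 1≤j j≤n A) f) (fibre As))
      AP.∷ UniqueP.map⁺ VecP.∷-injectiveʳ (fibre-Unique As fs))
    where
    differ : ∀ (B : Box n) {C : Box n} {t t′ : Row n _} {b} x → has B x ≡ b → has C x ≡ not b → B ∷ t ≢ C ∷ t′
    differ B {b = true}  x p q refl = clash p q
    differ B {b = false} x p q refl = clash q p

  concatMap-fibre-Unique : ∀ {k} {L : List (Row n k)} → LAll.All (Lacks j) L → Unique L → Unique (concatMap fibre L)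
  concatMap-fibre-Unique LAll.[] AP.[] = AP.[]
  concatMap-fibre-Unique {L = T₀ ∷ L} (l LAll.∷ ls) (T₀∉L AP.∷ uniq) =
    UniqueP.++⁺ (fibre-Unique T₀ l) (concatMap-fibre-Unique ls uniq) disjoint
    where
    disjoint : ∀ {T} → ¬ (T LMem.∈ fibre T₀ × T LMem.∈ concatMap fibre L)
    disjoint (p , q) with LMem.find (LMemP.∈-concatMap⁻ fibre {xs = L} q)
    ... | T₁ , T₁∈L , q′ = LAll.lookup T₀∉L T₁∈L
      (trans (sym (∈fibre⇒mergeRow T₀ l p)) (∈fibre⇒mergeRow T₁ (LAll.lookup ls T₁∈L) q′))

  Lacks? : ∀ {k} (T : Row n k) → Dec (Lacks j T)
  Lacks? = VAll.all? (λ A → has A j BoolP.≟ false)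

  expand : ∀ {k} → List (Row n k) → List (Row n k)
  expand L = concatMap fibre (filter Lacks? L)

  mergeRow-Lacksj : ∀ {k} (T : Row n k) → Lacks j (mergeRow i T)
  mergeRow-Lacksj []       = []
  mergeRow-Lacksj (A ∷ As) = merge-Lacksj i valid A ∷ mergeRow-Lacksj As

  expand-Enumerates : ∀ {k r} {L : List (Row n k)} →
    Enumerates L (λ T → Ascending T × Bounded r T) →
    Enumerates (expand L) (λ T → Ascending T × Bounded (bump i r) T)
  expand-Enumerates {r = r} {L} (uniq , spec) =
    concatMap-fibre-Unique (LAllP.all-filter Lacks? L) (UniqueP.filter⁺ Lacks? uniq) ,
    λ T → mk⇔ (to T) (from T)
    where
    to : ∀ T → T LMem.∈ expand L → Ascending T × Bounded (bump i r) T
    to T p with LMem.find (LMemP.∈-concatMap⁻ fibre {xs = filter Lacks? L} p)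
    ... | T₀ , q , p′ with LMemP.∈-filter⁻ Lacks? {xs = L} q
    ...   | T₀∈L , ls with Equivalence.to (spec T₀) T₀∈L
    ...     | as , b = ∈fibre⇒Ascending T₀ ls as p′ ,
      Bounded-mergeRow⇒ i valid r T (subst (Bounded r) (sym (∈fibre⇒mergeRow T₀ ls p′)) b)
    from : ∀ T → Ascending T × Bounded (bump i r) T → T LMem.∈ expand L
    from T (as , b) = LMemP.∈-concatMap⁺ fibre {xs = filter Lacks? L} (LMem.lose
      (LMemP.∈-filter⁺ Lacks? (Equivalence.from (spec (mergeRow i T))
          (Descent.ascending (descent i valid T as) , Bounded-mergeRow⇐ i valid r T b))
        (mergeRow-Lacksj T))
      (Ascending⇒∈fibre T as))

-- Exponent vectors

swapE-+ : ∀ {n} i → ValidIndex n i → (a b : Vec ℕ n) →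
          swapE i (zipWith _+_ a b) ≡ zipWith _+_ (swapE i a) (swapE i b)
swapE-+ (suc zero)    v              (_ ∷ _ ∷ _) (_ ∷ _ ∷ _) = refl
swapE-+ (suc zero)    (_ , s≤s ())   (_ ∷ [])    _
swapE-+ (suc (suc i)) (_ , s≤s lt)   (x ∷ a)     (y ∷ b)     = cong (x + y ∷_) (swapE-+ (suc i) (s≤s z≤n , lt) a b)

swapE-involutive : ∀ {n} i → ValidIndex n i → (a : Vec ℕ n) → swapE i (swapE i a) ≡ a
swapE-involutive (suc zero)    v            (_ ∷ _ ∷ _) = refl
swapE-involutive (suc zero)    (_ , s≤s ()) (_ ∷ [])
swapE-involutive (suc (suc i)) (_ , s≤s lt) (x ∷ a)     = cong (x ∷_) (swapE-involutive (suc i) (s≤s z≤n , lt) a)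

swapE-fixed : ∀ {n} i → ValidIndex n i → (a : Vec ℕ n) → getE a i ≡ getE a (suc i) → swapE i a ≡ a
swapE-fixed (suc zero)    v            (_ ∷ _ ∷ _) refl = refl
swapE-fixed (suc zero)    (_ , s≤s ()) (_ ∷ [])
swapE-fixed (suc (suc i)) (_ , s≤s lt) (x ∷ a)     eq   = cong (x ∷_) (swapE-fixed (suc i) (s≤s z≤n , lt) a eq)

unit : ∀ n → ℕ → Vec ℕ n
unit n x = setE (replicate n 0) x 1

swapE-unit : ∀ n i → ValidIndex n i → swapE i (unit n i) ≡ unit n (suc i)
swapE-unit (suc (suc n)) (suc zero)    v            = refl
swapE-unit (suc zero)    (suc zero)    (_ , s≤s ())
swapE-unit (suc n)       (suc (suc i)) (_ , s≤s lt) = cong (0 ∷_) (swapE-unit n (suc i) (s≤s z≤n , lt))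

getE-replicate : ∀ n x → getE (replicate n 0) x ≡ 0
getE-replicate zero    x             = refl
getE-replicate (suc n) zero          = refl
getE-replicate (suc n) (suc zero)    = refl
getE-replicate (suc n) (suc (suc x)) = getE-replicate n (suc x)

tabulate-0 : ∀ n → tabulate {n = n} (λ _ → 0) ≡ replicate n 0
tabulate-0 zero    = refl
tabulate-0 (suc n) = cong (0 ∷_) (tabulate-0 n)

zipWith-0ˡ : ∀ {n} (a : Vec ℕ n) → zipWith _+_ (replicate n 0) a ≡ a
zipWith-0ˡ = VecP.zipWith-identityˡ ℕP.+-identityˡ

sum-unit : ∀ {n} x → 1 ≤ x → x ≤ n → (a : Vec ℕ n) → Vec.sum (zipWith _+_ (unit n x) a) ≡ suc (Vec.sum a)
sum-unit (suc zero)    _ _        (y ∷ a) = cong (λ b → suc (y + Vec.sum b)) (zipWith-0ˡ a)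
sum-unit (suc (suc x)) _ (s≤s le) (y ∷ a) =
  trans (cong (y +_) (sum-unit (suc x) (s≤s z≤n) le a)) (ℕP.+-suc y _)

bit : Bool → ℕ
bit b = if b then 1 else 0

bits : ∀ {n} → Box n → Vec ℕ n
bits = Vec.map bit

getE-bits : ∀ {n} (A : Box n) x → getE (bits A) x ≡ bit (has A x)
getE-bits []      x             = refl
getE-bits (b ∷ A) zero          = refl
getE-bits (b ∷ A) (suc zero)    = refl
getE-bits (b ∷ A) (suc (suc x)) = getE-bits A (suc x)

bits-addL : ∀ {n} (A : Box n) x → 1 ≤ x → x ≤ n → has A x ≡ false →
            bits (addL x A) ≡ zipWith _+_ (unit n x) (bits A)
bits-addL (false ∷ A) (suc zero)    _ _        refl = cong (1 ∷_) (sym (zipWith-0ˡ (bits A)))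
bits-addL (b ∷ A)     (suc (suc x)) _ (s≤s le) f    = cong (bit b ∷_) (bits-addL A (suc x) (s≤s z≤n) le f)

∣∣-bits : ∀ {n} (A : Box n) → ∣ A ∣ ≡ Vec.sum (bits A)
∣∣-bits []          = refl
∣∣-bits (true ∷ A)  = cong suc (∣∣-bits A)
∣∣-bits (false ∷ A) = ∣∣-bits A

boxMono : ∀ {n} → Box n → Mono n
boxMono A = ∣ A ∣ ∸ 1 , bits A

rowMono : ∀ {n k} → Row n k → Mono n
rowMono T = ex T , wt T

wt-∷ : ∀ {n k} (A : Box n) (As : Row n k) → wt (A ∷ As) ≡ zipWith _+_ (bits A) (wt As)
wt-∷ A As = trans (tabulate-+ (bit ∘ lookup A) (count As))
  (cong (λ a → zipWith _+_ a (wt As)) (trans (VecP.tabulate-∘ bit (lookup A)) (cong bits (VecP.tabulate∘lookup A))))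
  where
  tabulate-+ : ∀ {n} (f g : Fin n → ℕ) → tabulate (λ x → f x + g x) ≡ zipWith _+_ (tabulate f) (tabulate g)
  tabulate-+ {zero}  f g = refl
  tabulate-+ {suc n} f g = cong (f zero + g zero ∷_) (tabulate-+ (f ∘ suc) (g ∘ suc))

rowMono-∷ : ∀ {n k} (A : Box n) (As : Row n k) → rowMono (A ∷ As) ≡ mulMono (boxMono A) (rowMono As)
rowMono-∷ A As = cong (ex (A ∷ As) ,_) (wt-∷ A As)

-- Monomials form a commutative monoid

mono-commutativeMonoid : ℕ → CommutativeMonoid _ _
mono-commutativeMonoid n = record
  { Carrier = Mono n
  ; _≈_ = _≡_
  ; _∙_ = mulMono
  ; ε   = 0 , replicate n 0
  ; isCommutativeMonoid = record
    { isMonoid = record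
      { isSemigroup = record
        { isMagma = record { isEquivalence = isEquivalence ; ∙-cong = cong₂ mulMono }
        ; assoc   = λ (x , a) (y , b) (z , c) → cong₂ _,_ (ℕP.+-assoc x y z) (VecP.zipWith-assoc ℕP.+-assoc a b c)
        }
      ; identity = (λ (x , a) → cong (x ,_) (zipWith-0ˡ a))
                 , (λ (x , a) → cong₂ _,_ (ℕP.+-identityʳ x) (VecP.zipWith-identityʳ ℕP.+-identityʳ a))
      }
    ; comm = λ (x , a) (y , b) → cong₂ _,_ (ℕP.+-comm x y) (VecP.zipWith-comm ℕP.+-comm a b)
    }
  }

swapM : ∀ {n} → ℕ → Mono n → Mono n
swapM i (b , a) = b , swapE i a

-- A polynomial is handled through the linear functionals extending functions on monomials.

⟦_⟧ : ∀ {n} → Poly n → (Mono n → ℤ) → ℤ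
⟦ [] ⟧          φ = ℤ.0ℤ
⟦ (c , m) ∷ p ⟧ φ = c ℤ.* φ m ℤ.+ ⟦ p ⟧ φ

indicator : ∀ {n} → Mono n → Mono n → ℤ
indicator m m′ with ≡-dec ℕP._≟_ (VecP.≡-dec ℕP._≟_) m′ m
... | yes _ = ℤ.1ℤ
... | no  _ = ℤ.0ℤ

coeff-⟦⟧ : ∀ {n} (p : Poly n) m → coeff p m ≡ ⟦ p ⟧ (indicator m)
coeff-⟦⟧ []             m = refl
coeff-⟦⟧ ((c , m′) ∷ p) m with ≡-dec ℕP._≟_ (VecP.≡-dec ℕP._≟_) m′ m
... | yes _ = cong₂ ℤ._+_ (sym (ℤP.*-identityʳ c)) (coeff-⟦⟧ p m)
... | no  _ = trans (coeff-⟦⟧ p m) (sym (trans (cong (ℤ._+ _) (ℤP.*-zeroʳ c)) (ℤP.+-identityˡ _)))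

-- Indicators of monomials would suffice as tests. Allowing every `φ` lets s_i and multiplication by
-- a monomial be absorbed into `φ`, which the inductions below rely on.
⟦⟧-ext : ∀ {n} {p q : Poly n} → (∀ φ → ⟦ p ⟧ φ ≡ ⟦ q ⟧ φ) → p ≈P q
⟦⟧-ext {p = p} {q} eq m = trans (coeff-⟦⟧ p m) (trans (eq (indicator m)) (sym (coeff-⟦⟧ q m)))

module _ {n : ℕ} where

  ⟦++⟧ : (p q : Poly n) → ∀ φ → ⟦ p ++ q ⟧ φ ≡ ⟦ p ⟧ φ ℤ.+ ⟦ q ⟧ φ
  ⟦++⟧ []            q φ = sym (ℤP.+-identityˡ _)
  ⟦++⟧ ((c , m) ∷ p) q φ = trans (cong (ℤ._+_ (c ℤ.* φ m)) (⟦++⟧ p q φ)) (sym (ℤP.+-assoc (c ℤ.* φ m) _ _))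

  ⟦-P⟧ : (p : Poly n) → ∀ φ → ⟦ -P p ⟧ φ ≡ ℤ.- ⟦ p ⟧ φ
  ⟦-P⟧ []            φ = refl
  ⟦-P⟧ ((c , m) ∷ p) φ = trans (cong₂ ℤ._+_ (sym (ℤP.neg-distribˡ-* c (φ m))) (⟦-P⟧ p φ))
    (sym (ℤP.neg-distrib-+ (c ℤ.* φ m) (⟦ p ⟧ φ)))

  ⟦sP⟧ : ∀ i (p : Poly n) φ → ⟦ sP i p ⟧ φ ≡ ⟦ p ⟧ (φ ∘ swapM i)
  ⟦sP⟧ i []            φ = refl
  ⟦sP⟧ i ((c , m) ∷ p) φ = cong (ℤ._+_ (c ℤ.* φ (swapM i m))) (⟦sP⟧ i p φ)

  ⟦*P⟧ : (p q : Poly n) → ∀ φ → ⟦ p *P q ⟧ φ ≡ ⟦ p ⟧ (λ m → ⟦ q ⟧ (φ ∘ mulMono m))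
  ⟦*P⟧ []            q φ = refl
  ⟦*P⟧ ((c , m) ∷ p) q φ = trans (⟦++⟧ (row q) (p *P q) φ) (cong₂ ℤ._+_ (⟦row⟧ q) (⟦*P⟧ p q φ))
    where
    row : Poly n → Poly n
    row = map _
    ⟦row⟧ : ∀ q → ⟦ row q ⟧ φ ≡ c ℤ.* ⟦ q ⟧ (φ ∘ mulMono m)
    ⟦row⟧ []              = sym (ℤP.*-zeroʳ c)
    ⟦row⟧ ((c′ , m′) ∷ q) = trans (cong₂ ℤ._+_ (ℤP.*-assoc c c′ _) (⟦row⟧ q)) (sym (ℤP.*-distribˡ-+ c _ _))

-- Functionals summed over lists of rows

rowSum : ∀ {n k} → List (Row n k) → (Mono n → ℤ) → ℤ
rowSum []       φ = ℤ.0ℤ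
rowSum (T ∷ Ts) φ = φ (rowMono T) ℤ.+ rowSum Ts φ

⟦genFun⟧ : ∀ {n k} (L : List (Row n k)) φ → ⟦ genFun L ⟧ φ ≡ rowSum L φ
⟦genFun⟧ []       φ = refl
⟦genFun⟧ (T ∷ Ts) φ = cong₂ ℤ._+_ (ℤP.*-identityˡ (φ (rowMono T))) (⟦genFun⟧ Ts φ)

module _ {n k : ℕ} where

  rowSum-cong : (L : List (Row n k)) → ∀ {φ ψ} → (∀ m → φ m ≡ ψ m) → rowSum L φ ≡ rowSum L ψ
  rowSum-cong []       eq = refl
  rowSum-cong (T ∷ Ts) eq = cong₂ ℤ._+_ (eq _) (rowSum-cong Ts eq)

  rowSum-++ : (L M : List (Row n k)) → ∀ φ → rowSum (L ++ M) φ ≡ rowSum L φ ℤ.+ rowSum M φ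
  rowSum-++ []       M φ = sym (ℤP.+-identityˡ _)
  rowSum-++ (T ∷ Ts) M φ = trans (cong (ℤ._+_ (φ (rowMono T))) (rowSum-++ Ts M φ)) (sym (ℤP.+-assoc (φ (rowMono T)) _ _))

  rowSum-map∷ : (A : Box n) (L : List (Row n k)) → ∀ φ → rowSum (map (A ∷_) L) φ ≡ rowSum L (φ ∘ mulMono (boxMono A))
  rowSum-map∷ A []       φ = refl
  rowSum-map∷ A (T ∷ Ts) φ = cong₂ ℤ._+_ (cong φ (rowMono-∷ A T)) (rowSum-map∷ A Ts φ)

  rowSum-↭ : {L M : List (Row n k)} → L ↭ M → ∀ φ → rowSum L φ ≡ rowSum M φ
  rowSum-↭ ↭.refl         φ = refl
  rowSum-↭ (↭.prep T p)   φ = cong (ℤ._+_ (φ (rowMono T))) (rowSum-↭ p φ)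
  rowSum-↭ (↭.swap {xs} {ys} T U p) φ =
    trans (cong (λ s → φ (rowMono T) ℤ.+ (φ (rowMono U) ℤ.+ s)) (rowSum-↭ p φ))
          (exchange₂ (φ (rowMono T)) (φ (rowMono U)) (rowSum ys φ))
    where
    exchange₂ : ∀ a b c → a ℤ.+ (b ℤ.+ c) ≡ b ℤ.+ (a ℤ.+ c)
    exchange₂ = solve-∀
  rowSum-↭ (↭.trans p q)  φ = trans (rowSum-↭ p φ) (rowSum-↭ q φ)

  -- The four-term pattern is that of `numerator`.
  rowSum-linear : (L : List (Row n k)) → ∀ {φ₁ φ₂ φ₃ φ₄} →
    rowSum L (λ m → (φ₁ m ℤ.+ φ₂ m) ℤ.- (φ₃ m ℤ.+ φ₄ m))
      ≡ (rowSum L φ₁ ℤ.+ rowSum L φ₂) ℤ.- (rowSum L φ₃ ℤ.+ rowSum L φ₄)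
  rowSum-linear []       = refl
  rowSum-linear (T ∷ Ts) {φ₁} {φ₂} {φ₃} {φ₄} =
    trans (cong (λ s → ((φ₁ m ℤ.+ φ₂ m) ℤ.- (φ₃ m ℤ.+ φ₄ m)) ℤ.+ s) (rowSum-linear Ts))
          (regroup (φ₁ m) (φ₂ m) (φ₃ m) (φ₄ m) _ _ _ _)
    where
    m = rowMono T
    regroup : ∀ a b c d a′ b′ c′ d′ →
      ((a ℤ.+ b) ℤ.- (c ℤ.+ d)) ℤ.+ ((a′ ℤ.+ b′) ℤ.- (c′ ℤ.+ d′))
        ≡ ((a ℤ.+ a′) ℤ.+ (b ℤ.+ b′)) ℤ.- ((c ℤ.+ c′) ℤ.+ (d ℤ.+ d′))
    regroup = solve-∀

-- Generating function of a fibre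

module _ {n : ℕ} (i : ℕ) (valid : ValidIndex n i) where

  open Index valid

  private
    j = suc i

    X Y βXY : Mono n
    X   = xPow n i 1
    Y   = xPow n j 1
    βXY = mulMono (βm n) (mulMono X Y)

    s : Mono n → Mono n
    s = swapM i

    infixr 7 _∙_
    _∙_ : Mono n → Mono n → Mono n
    _∙_ = mulMono

  open MonoSolver (mono-commutativeMonoid n) using (solve; _⊕_; _⊜_)

  s-∙ : ∀ m m′ → s (m ∙ m′) ≡ s m ∙ s m′
  s-∙ (_ , a) (_ , a′) = cong (_ ,_) (swapE-+ i valid a a′)

  s-involutive : ∀ m → s (s m) ≡ m
  s-involutive (_ , a) = cong (_ ,_) (swapE-involutive i valid a)

  s-X : s X ≡ Y
  s-X = cong (_ ,_) (swapE-unit n i valid)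

  s-Y : s Y ≡ X
  s-Y = trans (cong s (sym s-X)) (s-involutive X)

  s-βXY : s βXY ≡ βXY
  s-βXY = begin
    s βXY                 ≡⟨ s-∙ (βm n) (X ∙ Y) ⟩
    s (βm n) ∙ s (X ∙ Y)  ≡⟨ cong₂ _∙_ s-β (trans (s-∙ X Y) (cong₂ _∙_ s-X s-Y)) ⟩
    βm n ∙ (Y ∙ X)        ≡⟨ solve 3 (λ b x y → b ⊕ (y ⊕ x) ⊜ b ⊕ (x ⊕ y)) refl (βm n) X Y ⟩
    βXY                   ∎
    where
    open ≡-Reasoning
    s-β : s (βm n) ≡ βm n
    s-β = cong (1 ,_) (swapE-fixed i valid _ (trans (getE-replicate n i) (sym (getE-replicate n j))))

  -- What remains of the monomial of `A` when its i is split off. The exponent of β counts all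
  -- remaining letters, without subtracting one: the letter i or i + 1 put back is the one that
  -- contributes no β.
  residue : Box n → Mono n
  residue A = Vec.sum (bits (remL i A)) , bits (remL i A)

  module _ (A : Box n) (t : has A i ≡ true) (f : has A j ≡ false) where

    private
      a = bits (remL i A)

      bits-A : bits A ≡ zipWith _+_ (unit n i) a
      bits-A = trans (cong bits (sym (trans (setL-setL A i) (setL-id A i t))))
                     (bits-addL (remL i A) i 1≤i i≤n (has-remL 1≤i i≤n A))

      j∉rem : has (remL i A) j ≡ false
      j∉rem = trans (has-setL-other A i false j j≢i) f

      bits-raise : bits (raise i A) ≡ zipWith _+_ (unit n j) a
      bits-raise = trans (cong bits (trans (raise-≡ i valid A t) (setL-comm A j i j≢i)))
                         (bits-addL (remL i A) j 1≤j j≤n j∉rem)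

      card : ∀ {B x b} → 1 ≤ x → x ≤ n → bits B ≡ zipWith _+_ (unit n x) b → ∣ B ∣ ≡ suc (Vec.sum b)
      card {B} {x} {b} 1≤x x≤n eq = trans (∣∣-bits B) (trans (cong Vec.sum eq) (sum-unit x 1≤x x≤n b))

    boxMono-residue : boxMono A ≡ X ∙ residue A
    boxMono-residue = cong₂ _,_ (cong (_∸ 1) (card 1≤i i≤n bits-A)) bits-A

    boxMono-raise : boxMono (raise i A) ≡ Y ∙ residue A
    boxMono-raise = cong₂ _,_ (cong (_∸ 1) (card 1≤j j≤n bits-raise)) bits-raise

    boxMono-addL : boxMono (addL j A) ≡ βXY ∙ residue A
    boxMono-addL = trans (cong₂ _,_ (cong (_∸ 1) ∣addL∣) bits-addLj)
      (solve 4 (λ b x y r → b ⊕ (y ⊕ (x ⊕ r)) ⊜ (b ⊕ (x ⊕ y)) ⊕ r) refl (βm n) X Y (residue A))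
      where
      bits-addLj′ : bits (addL j A) ≡ zipWith _+_ (unit n j) (bits A)
      bits-addLj′ = bits-addL A j 1≤j j≤n f
      ∣addL∣ : ∣ addL j A ∣ ≡ suc (suc (Vec.sum a))
      ∣addL∣ = trans (card 1≤j j≤n bits-addLj′) (cong suc (trans (sym (∣∣-bits A)) (card 1≤i i≤n bits-A)))
      bits-addLj : bits (addL j A) ≡ zipWith _+_ (replicate n 0) (zipWith _+_ (unit n j) (zipWith _+_ (unit n i) a))
      bits-addLj = trans bits-addLj′ (trans (cong (zipWith _+_ (unit n j)) bits-A) (sym (zipWith-0ˡ _)))

    s-residue : s (residue A) ≡ residue A
    s-residue = cong (Vec.sum a ,_) (swapE-fixed i valid a
      (trans (getE-bits (remL i A) i) (trans (cong bit (trans (has-remL 1≤i i≤n A) (sym j∉rem))) (sym (getE-bits (remL i A) j)))))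

    s-boxMono-raise : s (boxMono A) ≡ boxMono (raise i A)
    s-boxMono-raise = begin
      s (boxMono A)          ≡⟨ cong s boxMono-residue ⟩
      s (X ∙ residue A)      ≡⟨ s-∙ X (residue A) ⟩
      s X ∙ s (residue A)    ≡⟨ cong₂ _∙_ s-X s-residue ⟩
      Y ∙ residue A          ≡⟨ boxMono-raise ⟨
      boxMono (raise i A)    ∎ where open ≡-Reasoning

  s-boxMono-fixed : (A : Box n) → has A i ≡ false → has A j ≡ false → s (boxMono A) ≡ boxMono A
  s-boxMono-fixed A f f′ = cong (_ ,_) (swapE-fixed i valid (bits A)
    (trans (getE-bits A i) (trans (cong bit (trans f (sym f′))) (sym (getE-bits A j)))))

  s-boxMono : (A : Box n) → has A j ≡ false → s (boxMono A) ≡ boxMono (raise i A)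
  s-boxMono A f with has? A i
  ... | inj₁ t  = s-boxMono-raise A t f
  ... | inj₂ f′ = trans (s-boxMono-fixed A f′ f) (cong boxMono (sym (raise-Lacks i valid A f′)))

  rowMono-raiseRow : ∀ {k} (T : Row n k) → Lacks j T → rowMono (raiseRow i T) ≡ s (rowMono T)
  rowMono-raiseRow []       []       =
    cong (0 ,_) (trans (tabulate-0 n) (sym (trans (cong (swapE i) (tabulate-0 n))
      (trans (swapE-fixed i valid _ (trans (getE-replicate n i) (sym (getE-replicate n j)))) refl))))
  rowMono-raiseRow (A ∷ As) (f ∷ fs) = begin
    rowMono (raise i A ∷ raiseRow i As)             ≡⟨ rowMono-∷ (raise i A) (raiseRow i As) ⟩
    boxMono (raise i A) ∙ rowMono (raiseRow i As)   ≡⟨ cong₂ _∙_ (sym (s-boxMono A f)) (rowMono-raiseRow As fs) ⟩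
    s (boxMono A) ∙ s (rowMono As)                  ≡⟨ s-∙ (boxMono A) (rowMono As) ⟨
    s (boxMono A ∙ rowMono As)                      ≡⟨ cong s (rowMono-∷ A As) ⟨
    s (rowMono (A ∷ As))                            ∎ where open ≡-Reasoning

  rowMono-true : ∀ {k} (A : Box n) (As : Row n k) → has A i ≡ true → has A j ≡ false →
    rowMono (A ∷ As) ≡ X ∙ residue A ∙ rowMono As
  rowMono-true A As t f = trans (rowMono-∷ A As)
    (trans (cong (_∙ rowMono As) (boxMono-residue A t f)) (CommutativeMonoid.assoc (mono-commutativeMonoid n) X (residue A) _))

  s-rowMono-true : ∀ {k} (A : Box n) (As : Row n k) → has A i ≡ true → has A j ≡ false →
    s (rowMono (A ∷ As)) ≡ Y ∙ residue A ∙ s (rowMono As)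
  s-rowMono-true A As t f = begin
    s (rowMono (A ∷ As))                  ≡⟨ cong s (rowMono-true A As t f) ⟩
    s (X ∙ residue A ∙ rowMono As)        ≡⟨ s-∙ X (residue A ∙ rowMono As) ⟩
    s X ∙ s (residue A ∙ rowMono As)      ≡⟨ cong₂ _∙_ s-X (s-∙ (residue A) (rowMono As)) ⟩
    Y ∙ s (residue A) ∙ s (rowMono As)    ≡⟨ cong (λ r → Y ∙ r ∙ s (rowMono As)) (s-residue A t f) ⟩
    Y ∙ residue A ∙ s (rowMono As)        ∎ where open ≡-Reasoning

  rowSum-fibre-true : ∀ {k} (A : Box n) (As : Row n k) → has A i ≡ true → has A j ≡ false → Lacks j As → ∀ φ →
    rowSum (fibre i valid (A ∷ As)) φ
      ≡ φ (Y ∙ residue A ∙ s (rowMono As))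
        ℤ.+ (φ (βXY ∙ residue A ∙ s (rowMono As)) ℤ.+ rowSum (fibre i valid As) (λ m → φ (X ∙ residue A ∙ m)))
  rowSum-fibre-true A As t f fs φ = trans (cong (λ L → rowSum L φ) (fibre-true i valid A As t))
    (cong₂ ℤ._+_ (cong φ (first (boxMono-raise A t f)))
      (cong₂ ℤ._+_ (cong φ (first (boxMono-addL A t f)))
        (trans (rowSum-map∷ A (fibre i valid As) φ)
          (rowSum-cong (fibre i valid As) λ m → cong φ (trans (cong (_∙ m) (boxMono-residue A t f)) (reassoc X (residue A) m))))))
    where
    reassoc : ∀ x y z → (x ∙ y) ∙ z ≡ x ∙ y ∙ z
    reassoc = CommutativeMonoid.assoc (mono-commutativeMonoid n)
    first : ∀ {B x} → boxMono B ≡ x ∙ residue A → rowMono (B ∷ raiseRow i As) ≡ x ∙ residue A ∙ s (rowMono As)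
    first {B} {x} eq = trans (rowMono-∷ B (raiseRow i As))
      (trans (cong₂ _∙_ eq (rowMono-raiseRow As fs)) (reassoc x (residue A) _))

  rowSum-fibre-false : ∀ {k} (A : Box n) (As : Row n k) → has A i ≡ false → ∀ φ →
    rowSum (fibre i valid (A ∷ As)) φ ≡ rowSum (fibre i valid As) (λ m → φ (boxMono A ∙ m))
  rowSum-fibre-false A As f φ = trans (cong (λ L → rowSum L φ) (fibre-false i valid A As f)) (rowSum-map∷ A (fibre i valid As) φ)

  -- φ applied to (1 − s_i) ((x_i + β x_i x_{i+1}) m)
  numerator : (Mono n → ℤ) → Mono n → ℤ
  numerator φ m = (φ (X ∙ m) ℤ.+ φ (βXY ∙ m)) ℤ.- (φ (Y ∙ s m) ℤ.+ φ (βXY ∙ s m))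

  -- This is (X - Y) F = (1 - s_i)((X + βXY) m) for the fibre sum F of a row with monomial m. If `A`
  -- contains i and has residue r, the fibre sum of `A ∷ As` is Y r s(m) + βXY r s(m) + X r F, where
  -- m and F belong to `As`. After multiplication by X - Y and use of the induction hypothesis for
  -- F, the terms XY r s(m) and X βXY r s(m) cancel, which leaves the right side for the monomial X
  -- r m.
  rowSum-fibre : ∀ {k} (T : Row n k) → Lacks j T → ∀ φ →
    rowSum (fibre i valid T) (φ ∘ (X ∙_)) ℤ.- rowSum (fibre i valid T) (φ ∘ (Y ∙_)) ≡ numerator φ (rowMono T)
  rowSum-fibre {zero} [] _ φ = begin
    (φ (X ∙ m) ℤ.+ ℤ.0ℤ) ℤ.- (φ (Y ∙ m) ℤ.+ ℤ.0ℤ)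
      -- The monomial of the empty row is 1, which s_i fixes, so the same β-term may be inserted on
      -- both sides of the difference.
      ≡⟨ cancel (φ (X ∙ m)) (φ (Y ∙ m)) (φ (βXY ∙ m)) ⟩
    (φ (X ∙ m) ℤ.+ φ (βXY ∙ m)) ℤ.- (φ (Y ∙ m) ℤ.+ φ (βXY ∙ m))
      ≡⟨ cong (λ m′ → (φ (X ∙ m) ℤ.+ φ (βXY ∙ m)) ℤ.- (φ (Y ∙ m′) ℤ.+ φ (βXY ∙ m′))) (rowMono-raiseRow {zero} [] []) ⟩
    numerator φ m ∎
    where
    open ≡-Reasoning
    m = rowMono {n} []
    cancel : ∀ a b c → (a ℤ.+ ℤ.0ℤ) ℤ.- (b ℤ.+ ℤ.0ℤ) ≡ (a ℤ.+ c) ℤ.- (b ℤ.+ c)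
    cancel = solve-∀
  rowSum-fibre (A ∷ As) (f ∷ fs) φ with has? A i
  ... | inj₂ f′ = begin
    rowSum (fibre i valid (A ∷ As)) (φ ∘ (X ∙_)) ℤ.- rowSum (fibre i valid (A ∷ As)) (φ ∘ (Y ∙_))
      ≡⟨ cong₂ ℤ._-_ (trans (rowSum-fibre-false A As f′ _) (rowSum-cong (fibre i valid As) λ m′ → cong φ (pull X a m′)))
                     (trans (rowSum-fibre-false A As f′ _) (rowSum-cong (fibre i valid As) λ m′ → cong φ (pull Y a m′))) ⟩
    rowSum (fibre i valid As) (ψ ∘ (X ∙_)) ℤ.- rowSum (fibre i valid As) (ψ ∘ (Y ∙_))
      ≡⟨ rowSum-fibre As fs ψ ⟩
    numerator ψ m
      ≡⟨ cong₂ ℤ._-_ (cong₂ ℤ._+_ (cong φ (push-in X)) (cong φ (push-in βXY)))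
                     (cong₂ ℤ._+_ (cong φ (push-s Y)) (cong φ (push-s βXY))) ⟩
    numerator φ (rowMono (A ∷ As)) ∎
    where
    open ≡-Reasoning
    m = rowMono As
    a = boxMono A
    ψ : Mono n → ℤ
    ψ m′ = φ (a ∙ m′)
    pull : ∀ x y z → x ∙ y ∙ z ≡ y ∙ x ∙ z
    pull = solve 3 (λ x y z → x ⊕ (y ⊕ z) ⊜ y ⊕ (x ⊕ z)) refl
    push-in : ∀ x → a ∙ x ∙ m ≡ x ∙ rowMono (A ∷ As)
    push-in x = trans (pull a x m) (cong (x ∙_) (sym (rowMono-∷ A As)))
    push-s : ∀ x → a ∙ x ∙ s m ≡ x ∙ s (rowMono (A ∷ As))
    push-s x = trans (pull a x (s m)) (cong (x ∙_) (sym s-mono))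
      where
      s-mono : s (rowMono (A ∷ As)) ≡ a ∙ s m
      s-mono = trans (cong s (rowMono-∷ A As)) (trans (s-∙ a m) (cong (_∙ s m) (s-boxMono-fixed A f′ f)))
  ... | inj₁ t = begin
    rowSum (fibre i valid (A ∷ As)) (φ ∘ (X ∙_)) ℤ.- rowSum (fibre i valid (A ∷ As)) (φ ∘ (Y ∙_))
      ≡⟨ cong₂ ℤ._-_ sum-X sum-Y ⟩
    (ψ (Y ∙ s m) ℤ.+ (ψ (βXY ∙ s m) ℤ.+ rowSum F (ψ ∘ (X ∙_))))
      ℤ.- (φ (Y ∙ s m⁺) ℤ.+ (φ (βXY ∙ s m⁺) ℤ.+ rowSum F (ψ ∘ (Y ∙_))))
      ≡⟨ telescope (ψ (X ∙ m) ℤ.+ ψ (βXY ∙ m)) (ψ (Y ∙ s m)) (ψ (βXY ∙ s m)) (φ (Y ∙ s m⁺)) (φ (βXY ∙ s m⁺)) (rowSum-fibre As fs ψ) ⟩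
    (ψ (X ∙ m) ℤ.+ ψ (βXY ∙ m)) ℤ.- (φ (Y ∙ s m⁺) ℤ.+ φ (βXY ∙ s m⁺))
      ≡⟨ cong₂ (λ a b → (a ℤ.+ b) ℤ.- (φ (Y ∙ s m⁺) ℤ.+ φ (βXY ∙ s m⁺))) (cong φ (absorb X)) (cong φ (absorb βXY)) ⟩
    numerator φ m⁺ ∎
    where
    open ≡-Reasoning
    m  = rowMono As
    m⁺ = rowMono (A ∷ As)
    r  = residue A
    F  = fibre i valid As
    -- The factor X r of the unchanged head is moved into the functional, to which the induction
    -- hypothesis then applies.
    ψ : Mono n → ℤ
    ψ m′ = φ (X ∙ r ∙ m′)
    m⁺-X : m⁺ ≡ X ∙ r ∙ m
    m⁺-X = rowMono-true A As t f
    s-m⁺ : s m⁺ ≡ Y ∙ r ∙ s m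
    s-m⁺ = s-rowMono-true A As t f
    pull : ∀ w x y z → w ∙ x ∙ y ∙ z ≡ w ∙ y ∙ x ∙ z
    pull = solve 4 (λ w x y z → w ⊕ (x ⊕ (y ⊕ z)) ⊜ w ⊕ (y ⊕ (x ⊕ z))) refl
    rotate : ∀ w x y z → w ∙ x ∙ y ∙ z ≡ x ∙ y ∙ w ∙ z
    rotate = solve 4 (λ w x y z → w ⊕ (x ⊕ (y ⊕ z)) ⊜ x ⊕ (y ⊕ (w ⊕ z))) refl
    absorb : ∀ x → X ∙ r ∙ x ∙ m ≡ x ∙ m⁺
    absorb x = trans (sym (rotate x X r m)) (cong (x ∙_) (sym m⁺-X))
    swap-βXY : Y ∙ βXY ∙ r ∙ s m ≡ βXY ∙ s m⁺
    swap-βXY = trans (solve 4 (λ w x y z → w ⊕ (x ⊕ (y ⊕ z)) ⊜ x ⊕ (w ⊕ (y ⊕ z))) refl Y βXY r (s m))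
                     (cong (βXY ∙_) (sym s-m⁺))
    sum-X : rowSum (fibre i valid (A ∷ As)) (φ ∘ (X ∙_))
            ≡ ψ (Y ∙ s m) ℤ.+ (ψ (βXY ∙ s m) ℤ.+ rowSum F (ψ ∘ (X ∙_)))
    sum-X = trans (rowSum-fibre-true A As t f fs _)
      (cong₂ ℤ._+_ (cong φ (pull X Y r (s m))) (cong₂ ℤ._+_ (cong φ (pull X βXY r (s m)))
        (rowSum-cong F λ m′ → cong φ (pull X X r m′))))
    sum-Y : rowSum (fibre i valid (A ∷ As)) (φ ∘ (Y ∙_))
            ≡ φ (Y ∙ s m⁺) ℤ.+ (φ (βXY ∙ s m⁺) ℤ.+ rowSum F (ψ ∘ (Y ∙_)))
    sum-Y = trans (rowSum-fibre-true A As t f fs _)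
      (cong₂ ℤ._+_ (cong (φ ∘ (Y ∙_)) (sym s-m⁺)) (cong₂ ℤ._+_ (cong φ swap-βXY)
        (rowSum-cong F λ m′ → cong φ (rotate Y X r m′))))
    telescope : ∀ c p₁ p₂ q₁ q₂ {s₁ s₂} → s₁ ℤ.- s₂ ≡ c ℤ.- (p₁ ℤ.+ p₂) →
      (p₁ ℤ.+ (p₂ ℤ.+ s₁)) ℤ.- (q₁ ℤ.+ (q₂ ℤ.+ s₂)) ≡ c ℤ.- (q₁ ℤ.+ q₂)
    telescope c p₁ p₂ q₁ q₂ {s₁} {s₂} eq =
      trans (split p₁ p₂ q₁ q₂ s₁ s₂) (trans (cong (λ d → d ℤ.+ ((p₁ ℤ.+ p₂) ℤ.- (q₁ ℤ.+ q₂))) eq) (join c p₁ p₂ q₁ q₂))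
      where
      split : ∀ p₁ p₂ q₁ q₂ s₁ s₂ → (p₁ ℤ.+ (p₂ ℤ.+ s₁)) ℤ.- (q₁ ℤ.+ (q₂ ℤ.+ s₂))
              ≡ (s₁ ℤ.- s₂) ℤ.+ ((p₁ ℤ.+ p₂) ℤ.- (q₁ ℤ.+ q₂))
      split = solve-∀
      join : ∀ c p₁ p₂ q₁ q₂ → (c ℤ.- (p₁ ℤ.+ p₂)) ℤ.+ ((p₁ ℤ.+ p₂) ℤ.- (q₁ ℤ.+ q₂)) ≡ c ℤ.- (q₁ ℤ.+ q₂)
      join = solve-∀

  -- If `A` contains i, applying s_i to Y r s(m) + βXY r s(m) + X r F gives X r m + βXY r m + Y r F,
  -- as F is invariant by induction. The two expressions are equal because (X - Y) F is the
  -- numerator of m, which is `rowSum-fibre` for `As`.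
  rowSum-fibre-swap : ∀ {k} (T : Row n k) → Lacks j T → ∀ φ →
    rowSum (fibre i valid T) (φ ∘ s) ≡ rowSum (fibre i valid T) φ
  rowSum-fibre-swap {zero} [] _ φ = cong (λ m → φ m ℤ.+ ℤ.0ℤ) (sym (rowMono-raiseRow {zero} [] []))
  rowSum-fibre-swap (A ∷ As) (f ∷ fs) φ with has? A i
  ... | inj₂ f′ = begin
    rowSum (fibre i valid (A ∷ As)) (φ ∘ s)  ≡⟨ rowSum-fibre-false A As f′ (φ ∘ s) ⟩
    rowSum F (λ m → φ (s (boxMono A ∙ m)))   ≡⟨ rowSum-cong F (λ m → cong φ (trans (s-∙ (boxMono A) m) (cong (_∙ s m) (s-boxMono-fixed A f′ f)))) ⟩
    rowSum F (λ m → φ (boxMono A ∙ s m))     ≡⟨ rowSum-fibre-swap As fs (φ ∘ (boxMono A ∙_)) ⟩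
    rowSum F (λ m → φ (boxMono A ∙ m))       ≡⟨ rowSum-fibre-false A As f′ φ ⟨
    rowSum (fibre i valid (A ∷ As)) φ        ∎
    where
    open ≡-Reasoning
    F = fibre i valid As
  ... | inj₁ t = begin
    rowSum (fibre i valid (A ∷ As)) (φ ∘ s)
      ≡⟨ rowSum-fibre-true A As t f fs (φ ∘ s) ⟩
    φ (s (Y ∙ r ∙ s m)) ℤ.+ (φ (s (βXY ∙ r ∙ s m)) ℤ.+ rowSum F (λ m′ → φ (s (X ∙ r ∙ m′))))
      ≡⟨ cong₂ ℤ._+_ (cong φ (s-Y∙r∙ (s m)))
           (cong₂ ℤ._+_ (cong φ (s-βXY∙r∙ (s m))) (rowSum-cong F λ m′ → cong φ (s-X∙r∙ m′))) ⟩
    φ (X ∙ r ∙ s (s m)) ℤ.+ (φ (βXY ∙ r ∙ s (s m)) ℤ.+ rowSum F (λ m′ → φ (Y ∙ r ∙ s m′)))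
      ≡⟨ cong₂ (λ m′ c → φ (X ∙ r ∙ m′) ℤ.+ (φ (βXY ∙ r ∙ m′) ℤ.+ c)) (s-involutive m)
           (trans (rowSum-fibre-swap As fs (λ m′ → φ (Y ∙ r ∙ m′))) (rowSum-cong F λ m′ → cong φ (pull Y r m′))) ⟩
    φ (X ∙ r ∙ m) ℤ.+ (φ (βXY ∙ r ∙ m) ℤ.+ rowSum F (ψ ∘ (Y ∙_)))
      ≡⟨ cong₂ (λ a b → a ℤ.+ (b ℤ.+ rowSum F (ψ ∘ (Y ∙_)))) (cong φ (pull X r m)) (cong φ (pull βXY r m)) ⟩
    ψ (X ∙ m) ℤ.+ (ψ (βXY ∙ m) ℤ.+ rowSum F (ψ ∘ (Y ∙_)))
      ≡⟨ transpose (ψ (X ∙ m)) (ψ (βXY ∙ m)) (ψ (Y ∙ s m)) (ψ (βXY ∙ s m)) (rowSum F (ψ ∘ (X ∙_))) (rowSum F (ψ ∘ (Y ∙_))) (rowSum-fibre As fs ψ) ⟩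
    ψ (Y ∙ s m) ℤ.+ (ψ (βXY ∙ s m) ℤ.+ rowSum F (ψ ∘ (X ∙_)))
      ≡⟨ cong₂ ℤ._+_ (cong φ (pull r Y (s m))) (cong₂ ℤ._+_ (cong φ (pull r βXY (s m)))
           (rowSum-cong F λ m′ → cong φ (pull r X m′))) ⟩
    φ (Y ∙ r ∙ s m) ℤ.+ (φ (βXY ∙ r ∙ s m) ℤ.+ rowSum F (λ m′ → φ (X ∙ r ∙ m′)))
      ≡⟨ rowSum-fibre-true A As t f fs φ ⟨
    rowSum (fibre i valid (A ∷ As)) φ ∎
    where
    open ≡-Reasoning
    m = rowMono As
    r = residue A
    F = fibre i valid As
    ψ : Mono n → ℤ
    ψ m′ = φ (r ∙ m′)
    pull : ∀ x y z → x ∙ y ∙ z ≡ y ∙ x ∙ z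
    pull = solve 3 (λ x y z → x ⊕ (y ⊕ z) ⊜ y ⊕ (x ⊕ z)) refl
    s-∙r∙ : ∀ {x y} → s x ≡ y → ∀ m′ → s (x ∙ r ∙ m′) ≡ y ∙ r ∙ s m′
    s-∙r∙ {x} eq m′ = trans (s-∙ x (r ∙ m′)) (cong₂ _∙_ eq (trans (s-∙ r m′) (cong (_∙ s m′) (s-residue A t f))))
    s-X∙r∙   = s-∙r∙ s-X
    s-Y∙r∙   = s-∙r∙ s-Y
    s-βXY∙r∙ = s-∙r∙ s-βXY
    transpose : ∀ a b p₁ p₂ s₁ s₂ → s₁ ℤ.- s₂ ≡ (a ℤ.+ b) ℤ.- (p₁ ℤ.+ p₂) →
      a ℤ.+ (b ℤ.+ s₂) ≡ p₁ ℤ.+ (p₂ ℤ.+ s₁)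
    transpose a b p₁ p₂ s₁ s₂ eq = trans (split a b p₁ p₂ s₂)
      (trans (cong (ℤ._+ (p₁ ℤ.+ (p₂ ℤ.+ s₂))) (sym eq)) (join p₁ p₂ s₁ s₂))
      where
      split : ∀ a b p₁ p₂ s₂ → a ℤ.+ (b ℤ.+ s₂) ≡ ((a ℤ.+ b) ℤ.- (p₁ ℤ.+ p₂)) ℤ.+ (p₁ ℤ.+ (p₂ ℤ.+ s₂))
      split = solve-∀
      join : ∀ p₁ p₂ s₁ s₂ → (s₁ ℤ.- s₂) ℤ.+ (p₁ ℤ.+ (p₂ ℤ.+ s₂)) ≡ p₁ ℤ.+ (p₂ ℤ.+ s₁)
      join = solve-∀

  rowSum-fibres : ∀ {k} {L : List (Row n k)} → LAll.All (Lacks j) L → ∀ φ →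
    rowSum (concatMap (fibre i valid) L) (φ ∘ (X ∙_)) ℤ.- rowSum (concatMap (fibre i valid) L) (φ ∘ (Y ∙_))
      ≡ rowSum L (numerator φ)
  rowSum-fibres LAll.[] φ = refl
  rowSum-fibres {L = T ∷ L} (l LAll.∷ ls) φ = begin
    rowSum (fibre i valid T ++ Fs) φX ℤ.- rowSum (fibre i valid T ++ Fs) φY
      ≡⟨ cong₂ ℤ._-_ (rowSum-++ (fibre i valid T) Fs φX) (rowSum-++ (fibre i valid T) Fs φY) ⟩
    (rowSum (fibre i valid T) φX ℤ.+ rowSum Fs φX) ℤ.- (rowSum (fibre i valid T) φY ℤ.+ rowSum Fs φY)
      ≡⟨ regroup (rowSum (fibre i valid T) φX) (rowSum Fs φX) _ _ ⟩
    (rowSum (fibre i valid T) φX ℤ.- rowSum (fibre i valid T) φY) ℤ.+ (rowSum Fs φX ℤ.- rowSum Fs φY)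
      ≡⟨ cong₂ ℤ._+_ (rowSum-fibre T l φ) (rowSum-fibres ls φ) ⟩
    rowSum (T ∷ L) (numerator φ) ∎
    where
    open ≡-Reasoning
    Fs = concatMap (fibre i valid) L
    φX φY : Mono n → ℤ
    φX = φ ∘ (X ∙_)
    φY = φ ∘ (Y ∙_)
    regroup : ∀ a b c d → (a ℤ.+ b) ℤ.- (c ℤ.+ d) ≡ (a ℤ.- c) ℤ.+ (b ℤ.- d)
    regroup = solve-∀

  rowSum-fibres-swap : ∀ {k} {L : List (Row n k)} → LAll.All (Lacks j) L → ∀ φ →
    rowSum (concatMap (fibre i valid) L) (φ ∘ s) ≡ rowSum (concatMap (fibre i valid) L) φ
  rowSum-fibres-swap LAll.[] φ = refl
  rowSum-fibres-swap {L = T ∷ L} (l LAll.∷ ls) φ = begin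
    rowSum (fibre i valid T ++ Fs) (φ ∘ s)                       ≡⟨ rowSum-++ (fibre i valid T) Fs (φ ∘ s) ⟩
    rowSum (fibre i valid T) (φ ∘ s) ℤ.+ rowSum Fs (φ ∘ s)       ≡⟨ cong₂ ℤ._+_ (rowSum-fibre-swap T l φ) (rowSum-fibres-swap ls φ) ⟩
    rowSum (fibre i valid T) φ ℤ.+ rowSum Fs φ                   ≡⟨ rowSum-++ (fibre i valid T) Fs φ ⟨
    rowSum (fibre i valid T ++ Fs) φ                             ∎
    where
    open ≡-Reasoning
    Fs = concatMap (fibre i valid) L

  module _ {k : ℕ} {L : List (Row n k)} where

    private
      L′ = expand i valid L

    -- For i ≢ r the expansion is a rearrangement of L, whose generating function is then s_i-invariant.
    rowSum-expand : ∀ {r} → Enumerates L (λ T → Ascending T × Bounded r T) → ∀ φ →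
      rowSum L′ (φ ∘ (X ∙_)) ℤ.- rowSum L′ (φ ∘ (Y ∙_)) ≡ rowSum L (numerator φ)
    rowSum-expand {r} enum φ with i ≟ r
    ... | yes refl = subst
      (λ M → rowSum (concatMap (fibre i valid) M) (φ ∘ (X ∙_)) ℤ.- rowSum (concatMap (fibre i valid) M) (φ ∘ (Y ∙_))
             ≡ rowSum L (numerator φ))
      (sym (ListP.filter-all (Lacks? i valid) lacks)) (rowSum-fibres lacks φ)
      where
      bounded⇒lacks : ∀ {k} (T : Row n k) → Bounded i T → Lacks j T
      bounded⇒lacks []       []       = []
      bounded⇒lacks (A ∷ As) (b ∷ bs) with has? A j
      ... | inj₁ t = ⊥-elim (ℕP.<⇒≱ (ℕP.n<1+n i) (b j t))
      ... | inj₂ f = f ∷ bounded⇒lacks As bs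
      lacks : LAll.All (Lacks j) L
      lacks = LAll.tabulate λ {T} T∈L → bounded⇒lacks T (proj₂ (Equivalence.to (proj₂ enum T) T∈L))
    ... | no i≢r = begin
      rowSum L′ φX ℤ.- rowSum L′ φY
        -- For an s_i-invariant sum F one has (1 - s_i)((X + βXY) F) = (X - Y) F, because βXY is
        -- invariant as well; adding the β-terms brings the difference into the form of `numerator`.
        ≡⟨ pad (rowSum L′ φX) (rowSum L′ φY) (rowSum L′ φβ) ⟩
      (rowSum L′ φX ℤ.+ rowSum L′ φβ) ℤ.- (rowSum L′ φY ℤ.+ rowSum L′ φβ)
        ≡⟨ cong₂ (λ a b → (rowSum L′ φX ℤ.+ rowSum L′ φβ) ℤ.- (a ℤ.+ b)) (sym (symmetric φY)) (sym (symmetric φβ)) ⟩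
      (rowSum L′ φX ℤ.+ rowSum L′ φβ) ℤ.- (rowSum L′ (φY ∘ s) ℤ.+ rowSum L′ (φβ ∘ s))
        ≡⟨ rowSum-linear L′ ⟨
      rowSum L′ (numerator φ)
        ≡⟨ rowSum-↭ L′↭L (numerator φ) ⟩
      rowSum L (numerator φ) ∎
      where
      open ≡-Reasoning
      φX φY φβ : Mono n → ℤ
      φX = φ ∘ (X ∙_)
      φY = φ ∘ (Y ∙_)
      φβ = φ ∘ (βXY ∙_)
      pad : ∀ a b c → a ℤ.- b ≡ (a ℤ.+ c) ℤ.- (b ℤ.+ c)
      pad = solve-∀
      symmetric : ∀ ψ → rowSum L′ (ψ ∘ s) ≡ rowSum L′ ψ
      symmetric = rowSum-fibres-swap (LAllP.all-filter (Lacks? i valid) L)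
      bump-other : bump i r ≡ r
      bump-other with i ≟ r
      ... | yes i≡r = ⊥-elim (i≢r i≡r)
      ... | no _    = refl
      L′↭L : L′ ↭ L
      L′↭L with expand-Enumerates i valid enum
      ... | uniq′ , spec′ rewrite bump-other = ∼bag⇒↭ (unique∧set⇒bag uniq′ (proj₁ enum)
        λ {T} → mk⇔ (Equivalence.from (proj₂ enum T) ∘ Equivalence.to (spec′ T))
                    (Equivalence.from (spec′ T) ∘ Equivalence.to (proj₂ enum T)))

    -- Tested against `φ`, the identity that specifies the divided difference becomes
    -- `rowSum-expand`: its left side splits along X and -Y, its right side along the two terms of
    -- x_i + β x_i x_{i+1} and their images under s_i.
    expand-IsVarpi : ∀ {r} → Enumerates L (λ T → Ascending T × Bounded r T) →
                     IsVarpi n i (genFun L) (genFun L′)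
    expand-IsVarpi enum = ⟦⟧-ext {p = xDiff n i *P genFun L′} {N -P sP i N} λ φ → begin
      ⟦ xDiff n i *P genFun L′ ⟧ φ
        ≡⟨ ⟦*P⟧ (xDiff n i) (genFun L′) φ ⟩
      ℤ.1ℤ ℤ.* ⟦ genFun L′ ⟧ (φ ∘ (X ∙_)) ℤ.+ (ℤ.-1ℤ ℤ.* ⟦ genFun L′ ⟧ (φ ∘ (Y ∙_)) ℤ.+ ℤ.0ℤ)
        ≡⟨ cong₂ (λ a b → ℤ.1ℤ ℤ.* a ℤ.+ (ℤ.-1ℤ ℤ.* b ℤ.+ ℤ.0ℤ)) (⟦genFun⟧ L′ _) (⟦genFun⟧ L′ _) ⟩
      ℤ.1ℤ ℤ.* rowSum L′ (φ ∘ (X ∙_)) ℤ.+ (ℤ.-1ℤ ℤ.* rowSum L′ (φ ∘ (Y ∙_)) ℤ.+ ℤ.0ℤ)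
        ≡⟨ tidy-difference (rowSum L′ (φ ∘ (X ∙_))) _ ⟩
      rowSum L′ (φ ∘ (X ∙_)) ℤ.- rowSum L′ (φ ∘ (Y ∙_))
        ≡⟨ rowSum-expand enum φ ⟩
      rowSum L (numerator φ)
        ≡⟨ rowSum-linear L ⟩
      (rowSum L (φ ∘ (X ∙_)) ℤ.+ rowSum L (φ ∘ (βXY ∙_)))
        ℤ.- (rowSum L (λ m → φ (Y ∙ s m)) ℤ.+ rowSum L (λ m → φ (βXY ∙ s m)))
        ≡⟨ cong₂ ℤ._-_ (sym (⟦N⟧ φ)) (cong₂ ℤ._+_ (rowSum-cong L λ m → cong φ (sym (s-shift s-X m)))
                                                   (rowSum-cong L λ m → cong φ (sym (s-shift s-βXY m)))) ⟩
      ⟦ N ⟧ φ ℤ.- (rowSum L (φ ∘ s ∘ (X ∙_)) ℤ.+ rowSum L (φ ∘ s ∘ (βXY ∙_)))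
        ≡⟨ cong (λ z → ⟦ N ⟧ φ ℤ.- z) (sym (trans (⟦sP⟧ i N φ) (⟦N⟧ (φ ∘ s)))) ⟩
      ⟦ N ⟧ φ ℤ.- ⟦ sP i N ⟧ φ
        ≡⟨ cong (ℤ._+_ (⟦ N ⟧ φ)) (⟦-P⟧ (sP i N) φ) ⟨
      ⟦ N ⟧ φ ℤ.+ ⟦ -P sP i N ⟧ φ
        ≡⟨ ⟦++⟧ N (-P sP i N) φ ⟨
      ⟦ N -P sP i N ⟧ φ ∎
      where
      open ≡-Reasoning
      N = xLas n i *P genFun L
      s-shift : ∀ {x y} → s x ≡ y → ∀ m → s (x ∙ m) ≡ y ∙ s m
      s-shift {x} eq m = trans (s-∙ x m) (cong (_∙ s m) eq)
      tidy-difference : ∀ a b → ℤ.1ℤ ℤ.* a ℤ.+ (ℤ.-1ℤ ℤ.* b ℤ.+ ℤ.0ℤ) ≡ a ℤ.- b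
      tidy-difference = solve-∀
      tidy-sum : ∀ a b → ℤ.1ℤ ℤ.* a ℤ.+ (ℤ.1ℤ ℤ.* b ℤ.+ ℤ.0ℤ) ≡ a ℤ.+ b
      tidy-sum = solve-∀
      ⟦N⟧ : ∀ φ → ⟦ N ⟧ φ ≡ rowSum L (φ ∘ (X ∙_)) ℤ.+ rowSum L (φ ∘ (βXY ∙_))
      ⟦N⟧ φ = trans (⟦*P⟧ (xLas n i) (genFun L) φ)
        (trans (cong₂ (λ a b → ℤ.1ℤ ℤ.* a ℤ.+ (ℤ.1ℤ ℤ.* b ℤ.+ ℤ.0ℤ)) (⟦genFun⟧ L _) (⟦genFun⟧ L _))
               (tidy-sum (rowSum L (φ ∘ (X ∙_))) (rowSum L (φ ∘ (βXY ∙_)))))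

-- The rows and the character attached to a word

module _ {n k : ℕ} (1≤n : 1 ≤ n) where

  demazureRows : ∀ word → ValidWord n word → List (Row n k)
  demazureRows []       _             = u n k ∷ []
  demazureRows (i ∷ is) (v LAll.∷ vs) = expand i v (demazureRows is vs)

  demazureRows-Enumerates : ∀ word (vs : ValidWord n word) →
    Enumerates (demazureRows word vs) (λ T → Ascending T × Bounded (rank word) T)
  demazureRows-Enumerates [] _ = LAll.[] AP.∷ AP.[] , λ T → mk⇔
    (λ { (LAny.here refl) → u-Ascending k 1≤n , u-Bounded k 1≤n })
    (λ { (as , b) → LAny.here (Bounded-1⇒u 1≤n T as b) })
  demazureRows-Enumerates (i ∷ is) (v LAll.∷ vs) = expand-Enumerates i v (demazureRows-Enumerates is vs)

  rowMono-u : rowMono (u n k) ≡ xPow n 1 k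
  rowMono-u = go n k 1≤n
    where
    go : ∀ n k → 1 ≤ n → rowMono (u n k) ≡ xPow n 1 k
    go (suc n) zero    _ = cong (λ a → 0 , 0 ∷ a) (tabulate-0 n)
    go (suc n) (suc k) le = begin
      rowMono (u (suc n) (suc k))                          ≡⟨ rowMono-∷ (addL 1 ⊥) (u (suc n) k) ⟩
      mulMono (boxMono (true ∷ ⊥ {n})) (rowMono (u (suc n) k)) ≡⟨ cong₂ mulMono one-box (go (suc n) k le) ⟩
      mulMono (0 , 1 ∷ replicate n 0) (0 , k ∷ replicate n 0)  ≡⟨ cong (λ a → 0 , suc k ∷ a) (zipWith-0ˡ (replicate n 0)) ⟩
      xPow (suc n) 1 (suc k)                               ∎
      where
      open ≡-Reasoning
      one-box : boxMono (true ∷ ⊥ {n}) ≡ (0 , 1 ∷ replicate n 0)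
      one-box = cong₂ (λ c a → c , 1 ∷ a) (∣⊥∣≡0 n) (VecP.map-replicate bit false n)

  demazureRows-VarpiChain : ∀ word (vs : ValidWord n word) →
    VarpiChain n word (term oneℤ (xPow n 1 k)) (genFun (demazureRows word vs))
  demazureRows-VarpiChain []       _             = cong (term oneℤ) rowMono-u
  demazureRows-VarpiChain (i ∷ is) (v LAll.∷ vs) =
    genFun (demazureRows is vs) , demazureRows-VarpiChain is vs , expand-IsVarpi i v (demazureRows-Enumerates is vs)

theorem7p5 : (n k : ℕ) → 2 ≤ n → 1 ≤ k →
  -- (K.1) connectedness of the graph with edges T → f_i T, T → f_i^K T
  ((T T' : Row n k) → SVT T → SVT T' → Connected n k T T')
  -- (K.1) u ∈ SVT and e_i u = 0, e_i^K u = 0 for all i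
  × SVT (u n k)
  × ((i : ℕ) → ValidIndex n i → e i (u n k) ≡ nothing × eK i (u n k) ≡ nothing)
  -- (K.1) u is the only such element
  × ((T : Row n k) → SVT T →
      ((i : ℕ) → ValidIndex n i → e i T ≡ nothing × eK i T ≡ nothing) →
      T ≡ u n k)
  -- (K.2) independence of the reduced expression
  × ((w : Permutation′ n) (a b : List ℕ) → Reduced n w a → Reduced n w b →
      (T : Row n k) → InDem n k a T ⇔ InDem n k b T)
  -- (K.3) character formula
  × ((w : Permutation′ n) (a : List ℕ) → Reduced n w a →
      ∃ λ (L : List (Row n k)) → ∃ λ (g : Poly n) →
        Enumerates L (InDem n k a)
        × VarpiChain n a (term oneℤ (xPow n 1 k)) g
        × genFun L ≈P g)
theorem7p5 n k 2≤n _ =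
    connected-SVT 1≤n
  , Ascending⇒SVT (u n k) (u-Ascending k 1≤n)
  , u-highest-weight 1≤n
  , highest-weight-unique 1≤n
  , (λ w a b ra rb T → mk⇔ (transfer w a b ra rb T) (transfer w b a rb ra T))
  , character
  where
  1≤n : 1 ≤ n
  1≤n = ℕP.<⇒≤ 2≤n

  transfer : ∀ w a b → Reduced n w a → Reduced n w b → ∀ T → InDem n k a T → InDem n k b T
  transfer w a b ra@((va , _) , _) rb@((vb , _) , _) T p with InDem⇒ 1≤n {a} va p
  -- Membership for a word is boundedness by its rank, and both ranks equal w(1).
  ... | as , bd = ⇒InDem 1≤n {b} vb (as , subst (λ r → Bounded r T) (rank-Reduced {w = w} {a} 1≤n ra {b} rb) bd)

  character : ∀ w a → Reduced n w a → ∃ λ (L : List (Row n k)) → ∃ λ (g : Poly n) →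
    Enumerates L (InDem n k a) × VarpiChain n a (term oneℤ (xPow n 1 k)) g × genFun L ≈P g
  character w a ((va , _) , _) with demazureRows-Enumerates {k = k} 1≤n a va
  ... | uniq , spec = demazureRows 1≤n a va , genFun (demazureRows 1≤n a va)
    , (uniq , λ T → mk⇔ (⇒InDem 1≤n {a} va ∘ Equivalence.to (spec T)) (Equivalence.from (spec T) ∘ InDem⇒ 1≤n {a} va))
    , demazureRows-VarpiChain 1≤n a va
    , λ m → refl
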